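{- Let $\mathfrak F$ be a non-trivial commutative group, let $I=\{p,q,r,s,t\}$ be a set with five elements, and let $(\mathcal G,\varphi,C)$ be the shifted group coset system constructed from $\mathfrak F$ as described in the context (for any choice of the data $\langle H_{xy}\rangle$, $\langle\alpha(\pi)\rangle$ and $f$ allowed there). Then the polygroupoid $\mathfrak P(\mathcal G,\varphi,C)$ is not representable.
   Context: **General notation.** Groups are written multiplicatively, with operation $\circ$, identity $e$, inverse $g^{ -1}$. For subsets $X,Y$ of a group, $X\circ Y=\{a\circ b: a\in X,b\in Y\}$; singletons are identified with their elements. For a normal subgroup $H$ of a group $\mathfrak G$ with universe $G$: $g/H=g\circ H$, and $G/H$ is the set of cosets of $H$. If $\psi$ is a map defined on the cosets of $H$, whose values are cosets of $K$, and $X$ is a union of cosets of $H$, then $\psi(X)$ or $\psi[X]$ also denotes the union of the values $\psi(g/H)$ over the cosets $g/H\subseteq X$ (a union of cosets is identified with the set of these cosets). Composition of functions (and binary relations) is relational: $R\mid S=\{(u,v): (u,w)\in R,\ (w,v)\in S\text{ for some }w\}$; for functions $(f\mid g)(u)=g(f(u))$. $[u,v]$ denotes the transposition of a given set interchanging $u$ and $v$ and fixing all other elements. **Polygroupoids.** A polygroupoid is a structure $\mathfrak M=(M,\circ,I,{}^{ -1})$ where $\circ$ assigns to each pair $a,b\in M$ a (possibly empty) subset $a\circ b\subseteq M$ (extended to subsets by $X\circ Y=\bigcup\{a\circ b:a\in X,b\in Y\}$), $I\subseteq M$, ${}^{ -1}$ is a unary operation on $M$, and for all $a,b,c\in M$: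 (i) $(a\circ b)\circ c=a\circ(b\circ c)$; (ii) $a\circ I=\{a\}=I\circ a$; (iii) $a\in b\circ c$ iff $b\in a\circ c^{ -1}$ iff $c\in b^{ -1}\circ a$. **Representability.** A representation of $\mathfrak M$ on a set $U$ is a function $\mathrm{rep}$ assigning to each $a\in M$ a nonempty binary relation $\mathrm{rep}(a)\subseteq U\times U$, with $\mathrm{rep}(a)\cap \mathrm{rep}(b)=\emptyset$ for $a\neq b$, such that for all $a,b\in M$: $\mathrm{rep}(a)\mid \mathrm{rep}(b)=\bigcup\{\mathrm{rep}(c): c\in a\circ b\}$; $\mathrm{rep}(x)\subseteq\{(u,u):u\in U\}$ for $x\in I$; and $\mathrm{rep}(a)^{ -1}=\mathrm{rep}(a^{ -1})$, where $R^{ -1}=\{(v,u):(u,v)\in R\}$. $\mathfrak M$ is representable if it has a representation on some set. **The group system.** Let $F$ be the universe of $\mathfrak F$. Let $L_0=\{(a,e,e):a\in F\}$, $L_1=\{(e,a,e):a\in F\}$, $L_2=\{(e,e,a):a\in F\}$, $L_3=\{(a,a,a):a\in F\}$, subgroups of $\mathfrak F\times\mathfrak F\times\mathfrak F$. Put $\mathfrak G_x=\mathfrak F\times\mathfrak F\times\mathfrak F$ for all $x\in I$, and $\mathcal G=\langle\mathfrak G_x:x\in I\rangle$. Let $H_{xx}=\{e\}$ (the trivial subgroup), and for distinct $x,y\in I$ choose $H_{xy}\in\{L_0,L_1,L_2,L_3\}$ so that $\{H_{xy}:y\in I,y\neq x\}=\{L_i:i<4\}$ for each $x\in I$. For distinct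 $x,y\in I$ let $\pi_{xy}$ be the permutation of $\{L_i:i<4\}$ with $\pi_{xy}(H_{xy})=H_{yx}$ and $\pi_{xy}(H_{xu})=H_{yu}$ for $u\in I\setminus\{x,y\}$. Let $\Pi$ be the set of permutations of $\{L_i:i<4\}$ and let $\langle\alpha(\pi):\pi\in\Pi\rangle$ be a system of automorphisms of $\mathfrak F\times\mathfrak F\times\mathfrak F$ such that for all $\pi,\sigma\in\Pi$: $\alpha(\pi)[L_m]=\pi(L_m)$ for $m<4$; $\alpha$ of the identity permutation is the identity; $\alpha(\pi^{ -1})=\alpha(\pi)^{ -1}$; $\alpha(\pi)\mid\alpha(\sigma)=\alpha(\pi\mid\sigma)$; and for distinct $m,n,k<4$, $\alpha([L_m,L_n])$ is the identity on $L_k$. Put $\alpha_{xy}=\alpha(\pi_{xy})$ for $x\ne y$ and let $\varphi_{xy}:\mathfrak G_x/H_{xy}\to\mathfrak G_y/H_{yx}$ be given by $\varphi_{xy}(g/H_{xy})=\alpha_{xy}(g)/H_{yx}$; let $\varphi_{xx}$ be the identity on $\mathfrak G_x/\{e\}$. Put $\varphi=\langle\varphi_{xy}:x,y\in I\rangle$. **The shift.** Let $f\in F\times F\times F$ with $f\notin H_{pq}\circ H_{pr}$, and put $f_p=f$, $f_q=\alpha_{pq}(f)$, $f_r=\alpha_{pr}(f)$. Call $(p,q,r),(q,r,p),(r,p,q)$ the positive permutations of $(p,q,r)$ and the other three permutations negative. Define $C=\langle C_{xyz}:x,y,z\in I\rangle$ by: $C_{xyz}=f_x/(H_{xy}\circ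 H_{xz})$ if $(x,y,z)$ is a positive permutation of $(p,q,r)$; $C_{xyz}=f_x^{ -1}/(H_{xy}\circ H_{xz})$ if it is a negative permutation of $(p,q,r)$; $C_{xyz}=H_{xy}\circ H_{xz}$ if $(x,y,z)$ is not a permutation of $(p,q,r)$. **The structure $\mathfrak P(\mathcal G,\varphi,C)$.** Its universe is $P=\{(x,g,y): x,y\in I,\ g\in G_x/H_{xy}\}$, where $G_x$ is the universe of $\mathfrak G_x$. The product of $(x,g,y)$ and $(w,h,z)$ is undefined (empty) if $y\neq w$, and $$(x,g,y)(y,h,z)=\{(x,k,z): k\in G_x/H_{xz},\ k\subseteq\varphi_{yx}(\varphi_{xy}(g)\circ h)\circ C_{xyz}\}.$$ The set of identities is $\{(x,H_{xx},x):x\in I\}$, and $(x,g,y)^{ -1}=(y,\varphi_{xy}(g^{ -1}),x)$. -}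

module Defs where

open import Algebra.Bundles using (AbelianGroup)
open import Algebra.Construct.DirectProduct using (abelianGroup)
open import Algebra.Morphism.Structures using (module GroupMorphisms)
import Algebra.Properties.AbelianGroup as AbelianGroupProperties
import Algebra.Properties.CommutativeSemigroup as CommutativeSemigroupProperties
import Algebra.Solver.CommutativeMonoid as CommutativeMonoidSolver
open import Data.Empty using (⊥-elim)
open import Data.Fin.Base using (Fin; zero; suc)
open import Data.Fin.Patterns using (0F; 1F; 2F; 3F; 4F)
open import Data.Fin.Permutation as Perm
  using (Permutation′; _⟨$⟩ʳ_; transpose; _∘ₚ_)
import Data.Fin.Properties as Fin
import Data.Nat.Properties as ℕ
open import Data.Product.Properties using (≡-dec)
open import Data.Product using (∃; ∃₂; Σ; _×_; _,_; proj₁; proj₂)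
open import Data.Sum using (_⊎_; inj₁; inj₂)
open import Function.Base using (flip)
open import Level using (Level; _⊔_; Lift; lift; lower) renaming (suc to lsuc)
open import Relation.Binary.Bundles using (Setoid)
open import Relation.Binary.Core using (Rel; _⇒_) renaming (_⇔_ to _≗_)
open import Relation.Binary.Definitions using (DecidableEquality)
open import Relation.Binary.PropositionalEquality as ≡
  using (_≡_; _≢_; ≢-sym)
open import Function.Bundles using (_⇔_; mk⇔)
open import Relation.Nullary using (¬_; Dec; yes; no)
open import Relation.Nullary.Decidable
  using (map′; from-yes; decidable-stable; dec-true; dec-false;
         ¬?; _×-dec_; _⊎-dec_; _→-dec_)
open import Relation.Unary using (Pred; _∈_; _∉_; _⊆_; _≐_)

------------------------------------------------------------------------
-- Polygroupoids and their representations

-- Sets are setoids here, because cosets are represented by their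
-- elements; every operation has to respect the setoid equality.
record Polygroupoid a ℓ m i : Set (lsuc (a ⊔ ℓ ⊔ m ⊔ i)) where
  infixl 7 _∘_ _∘ₛ_
  infix 8 _⁻¹
  field
    setoid : Setoid a ℓ
  open Setoid setoid public using (Carrier; _≈_)
  field
    _∘_ : Carrier → Carrier → Pred Carrier m
    Id  : Pred Carrier i
    _⁻¹ : Carrier → Carrier

  ｛_｝ : Carrier → Pred Carrier ℓ
  ｛ a ｝ b = a ≈ b

  _∘ₛ_ : ∀ {j k} → Pred Carrier j → Pred Carrier k → Pred Carrier _
  (X ∘ₛ Y) c = ∃₂ λ a b → a ∈ X × b ∈ Y × c ∈ a ∘ b

  field
    ∘-resp  : ∀ {a a′ b b′ c c′} → a ≈ a′ → b ≈ b′ → c ≈ c′ →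
              c ∈ a ∘ b → c′ ∈ a′ ∘ b′
    Id-resp : ∀ {a a′} → a ≈ a′ → a ∈ Id → a′ ∈ Id
    ⁻¹-cong : ∀ {a a′} → a ≈ a′ → a ⁻¹ ≈ a′ ⁻¹
    assoc     : ∀ a b c → (a ∘ b) ∘ₛ ｛ c ｝ ≐ ｛ a ｝ ∘ₛ (b ∘ c)
    identityʳ : ∀ a → ｛ a ｝ ∘ₛ Id ≐ ｛ a ｝
    identityˡ : ∀ a → Id ∘ₛ ｛ a ｝ ≐ ｛ a ｝
    cycle₁    : ∀ a b c → (a ∈ b ∘ c) ⇔ (b ∈ a ∘ c ⁻¹)
    cycle₂    : ∀ a b c → (a ∈ b ∘ c) ⇔ (c ∈ b ⁻¹ ∘ a)

record Representation {a ℓ m i u ℓᵤ} (𝔐 : Polygroupoid a ℓ m i)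
                      (𝕌 : Setoid u ℓᵤ) r
                      : Set (a ⊔ ℓ ⊔ m ⊔ i ⊔ u ⊔ ℓᵤ ⊔ lsuc r) where
  open Polygroupoid 𝔐
  open Setoid 𝕌 using () renaming (Carrier to U; _≈_ to _≈ᵤ_)
  field
    rep      : Carrier → Rel U r
    rep-resp : ∀ {a b u u′ v v′} → a ≈ b → u ≈ᵤ u′ → v ≈ᵤ v′ →
               rep a u v → rep b u′ v′
    nonempty : ∀ a → ∃₂ (rep a)
    disjoint : ∀ {a b} → ¬ (a ≈ b) → ∀ {u v} → ¬ (rep a u v × rep b u v)
    product  : ∀ a b → (λ u v → ∃ λ w → rep a u w × rep b w v) ≗
                       (λ u v → ∃ λ c → c ∈ a ∘ b × rep c u v)
    identity : ∀ {x} → x ∈ Id → rep x ⇒ _≈ᵤ_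
    converse : ∀ a → flip (rep a) ≗ rep (a ⁻¹)

Representable : ∀ {a ℓ m i} → Polygroupoid a ℓ m i →
                (u ℓᵤ r : Level) → Set (a ⊔ ℓ ⊔ m ⊔ i ⊔ lsuc (u ⊔ ℓᵤ ⊔ r))
Representable 𝔐 u ℓᵤ r = Σ (Setoid u ℓᵤ) λ 𝕌 → Representation 𝔐 𝕌 r

------------------------------------------------------------------------
-- Subsets and cosets in commutative groups

NonTrivial : ∀ {c ℓ} → AbelianGroup c ℓ → Set (c ⊔ ℓ)
NonTrivial 𝔉 = ∃ λ a → ¬ (a ≈ ε)
  where open AbelianGroup 𝔉

module Cosets {c ℓ} (𝔄 : AbelianGroup c ℓ) where
  open AbelianGroup 𝔄 using (Carrier; _≈_; _∙_; ε; _⁻¹)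

  infixl 7 _⊙_
  infix 6 _/_

  Subset : Set (lsuc (c ⊔ ℓ))
  Subset = Pred Carrier (c ⊔ ℓ)

  trivial : Subset
  trivial g = Lift c (g ≈ ε)

  _⊙_ : Subset → Subset → Subset
  (X ⊙ Y) g = ∃₂ λ a b → a ∈ X × b ∈ Y × g ≈ a ∙ b

  _/_ : Carrier → Subset → Subset
  (g / X) k = ∃ λ a → a ∈ X × k ≈ g ∙ a

  _[_] : (Carrier → Carrier) → Subset → Subset
  (θ [ X ]) k = ∃ λ a → a ∈ X × k ≈ θ a

------------------------------------------------------------------------
-- The index set

data I : Set where
  p q r s t : I

infix 4 _≟_

_≟_ : DecidableEquality I
p ≟ p = yes ≡.refl
p ≟ q = no λ ()
p ≟ r = no λ ()
p ≟ s = no λ ()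
p ≟ t = no λ ()
q ≟ p = no λ ()
q ≟ q = yes ≡.refl
q ≟ r = no λ ()
q ≟ s = no λ ()
q ≟ t = no λ ()
r ≟ p = no λ ()
r ≟ q = no λ ()
r ≟ r = yes ≡.refl
r ≟ s = no λ ()
r ≟ t = no λ ()
s ≟ p = no λ ()
s ≟ q = no λ ()
s ≟ r = no λ ()
s ≟ s = yes ≡.refl
s ≟ t = no λ ()
t ≟ p = no λ ()
t ≟ q = no λ ()
t ≟ r = no λ ()
t ≟ s = no λ ()
t ≟ t = yes ≡.refl

-- How a triple of indices is a permutation of (p,q,r).
data Kind : Set where
  positive negative neither : Kind

kind : I → I → I → Kind
kind p q r = positive
kind q r p = positive
kind r p q = positive
kind p r q = negative
kind q p r = negative
kind r q p = negative
kind _ _ _ = neither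

------------------------------------------------------------------------
-- The shifted group coset system

cube : ∀ {c ℓ} → AbelianGroup c ℓ → AbelianGroup c ℓ
cube 𝔉 = abelianGroup 𝔉 (abelianGroup 𝔉 𝔉)

module Lines {c ℓ} (𝔉 : AbelianGroup c ℓ) where
  open AbelianGroup 𝔉 using (ε)
  open AbelianGroup (cube 𝔉) using (_≈_)
  open Cosets (cube 𝔉) using (Subset; trivial)

  L : Fin 4 → Subset
  L 0F g = ∃ λ a → g ≈ (a , ε , ε)
  L 1F g = ∃ λ a → g ≈ (ε , a , ε)
  L 2F g = ∃ λ a → g ≈ (ε , ε , a)
  L 3F g = ∃ λ a → g ≈ (a , a , a)

  subgroup : (I → I → Fin 4) → I → I → Subset
  subgroup line x y with x ≟ y
  ... | yes _ = trivial
  ... | no  _ = L (line x y)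

-- The subgroups L 0F, …, L 3F of a non-trivial 𝔉 are pairwise distinct,
-- so a permutation of {L₀, L₁, L₂, L₃} is given by one of Fin 4.
record ShiftedSystem {c ℓ} (𝔉 : AbelianGroup c ℓ) : Set (lsuc (c ⊔ ℓ)) where
  open AbelianGroup (cube 𝔉)
    using (_≈_; _∙_; ε; _⁻¹; rawGroup) renaming (Carrier to G)
  open GroupMorphisms rawGroup rawGroup using (IsGroupIsomorphism)
  open Cosets (cube 𝔉)
  open Lines 𝔉

  -- For x ≢ y, line x y is the index of the line chosen as H x y; the
  -- values line x x play no role.
  field
    line      : I → I → Fin 4
    line-onto : ∀ x m → ∃ λ y → y ≢ x × line x y ≡ m

  H : I → I → Subset
  H = subgroup line

  -- These two equations determine π x y for x ≢ y, since line x maps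
  -- I ∖ {x} onto Fin 4; the values π x x play no role.
  field
    π       : I → I → Permutation′ 4
    π-swap  : ∀ {x y} → x ≢ y → π x y ⟨$⟩ʳ line x y ≡ line y x
    π-other : ∀ {x y u} → x ≢ y → u ≢ x → u ≢ y →
              π x y ⟨$⟩ʳ line x u ≡ line y u

  -- ρ ∘ₚ σ is first ρ, then σ, i.e. the relational composition ρ ∣ σ.
  field
    α           : Permutation′ 4 → G → G
    α-cong      : ∀ {ρ σ} → ρ Perm.≈ σ → ∀ g → α ρ g ≈ α σ g
    α-auto      : ∀ ρ → IsGroupIsomorphism (α ρ)
    α-line      : ∀ ρ m → α ρ [ L m ] ≐ L (ρ ⟨$⟩ʳ m)
    α-id        : ∀ g → α Perm.id g ≈ g
    α-flipˡ     : ∀ ρ g → α (Perm.flip ρ) (α ρ g) ≈ g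
    α-flipʳ     : ∀ ρ g → α ρ (α (Perm.flip ρ) g) ≈ g
    α-∘         : ∀ ρ σ g → α σ (α ρ g) ≈ α (ρ ∘ₚ σ) g
    α-transpose : ∀ {m n k} → m ≢ n → m ≢ k → n ≢ k →
                  ∀ {g} → g ∈ L k → α (transpose m n) g ≈ g

  field
    f  : G
    f∉ : f ∉ H p q ⊙ H p r

  αᵢ : I → I → G → G
  αᵢ x y g with x ≟ y
  ... | yes _ = g
  ... | no  _ = α (π x y) g

  -- φ x y applied to a union X of cosets of H x y.
  φ : I → I → Subset → Subset
  φ x y X k = ∃ λ g → g / H x y ⊆ X × k ∈ αᵢ x y g / H y x

  -- The values at s and t play no role.
  fᵢ : I → G
  fᵢ p = f
  fᵢ q = αᵢ p q f
  fᵢ r = αᵢ p r f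
  fᵢ _ = ε

  C : I → I → I → Subset
  C x y z with kind x y z
  ... | positive = fᵢ x / H x y ⊙ H x z
  ... | negative = fᵢ x ⁻¹ / H x y ⊙ H x z
  ... | neither  = H x y ⊙ H x z

  -- (x , g , y) stands for (x , g / H x y , y).
  P : Set c
  P = I × G × I

  infix 4 _≈ₚ_
  infixl 7 _∘ₚᵣ_

  _≈ₚ_ : Rel P (c ⊔ ℓ)
  (x , g , y) ≈ₚ (x′ , g′ , y′) =
    x ≡ x′ × y ≡ y′ × g / H x y ≐ g′ / H x′ y′

  _∘ₚᵣ_ : P → P → Pred P (c ⊔ ℓ)
  ((x , g , y) ∘ₚᵣ (w , h , z)) (x′ , k , z′) =
    y ≡ w × x′ ≡ x × z′ ≡ z ×
    k / H x z ⊆ φ y x (φ x y (g / H x y) ⊙ (h / H y z)) ⊙ C x y z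

  Idₚ : Pred P (c ⊔ ℓ)
  Idₚ a = ∃ λ x → (x , ε , x) ≈ₚ a

  invₚ : P → P
  invₚ (x , g , y) = y , αᵢ x y (g ⁻¹) , x

------------------------------------------------------------------------
-- Congruence modulo a subgroup

module CosetProperties {c ℓ} (𝔄 : AbelianGroup c ℓ) where
  open AbelianGroup 𝔄
  open Cosets 𝔄
  open AbelianGroupProperties 𝔄
    using (⁻¹-∙-comm; ε⁻¹≈ε)
  open CommutativeSemigroupProperties commutativeSemigroup
    using (interchange)

  record IsSubgroup (X : Subset) : Set (c ⊔ ℓ) where
    field
      resp : ∀ {a b} → a ≈ b → a ∈ X → b ∈ X
      ε∈   : ε ∈ X
      ∙∈   : ∀ {a b} → a ∈ X → b ∈ X → a ∙ b ∈ X
      ⁻¹∈  : ∀ {a} → a ∈ X → a ⁻¹ ∈ X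

  trivial-sub : IsSubgroup trivial
  trivial-sub = record
    { resp = λ e (lift x) → lift (trans (sym e) x)
    ; ε∈   = lift refl
    ; ∙∈   = λ (lift x) (lift y) → lift (trans (∙-cong x y) (identityˡ ε))
    ; ⁻¹∈  = λ (lift x) → lift (trans (⁻¹-cong x) ε⁻¹≈ε)
    }

  ⊙-sub : ∀ {X Y} → IsSubgroup X → IsSubgroup Y → IsSubgroup (X ⊙ Y)
  ⊙-sub SX SY = record
    { resp = λ e (a , b , a∈ , b∈ , g≈) → a , b , a∈ , b∈ , trans (sym e) g≈
    ; ε∈   = ε , ε , SX.ε∈ , SY.ε∈ , sym (identityˡ ε)
    ; ∙∈   = λ (a , b , a∈ , b∈ , g≈) (a′ , b′ , a′∈ , b′∈ , g′≈) →
        a ∙ a′ , b ∙ b′ , SX.∙∈ a∈ a′∈ , SY.∙∈ b∈ b′∈ ,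
        trans (∙-cong g≈ g′≈) (interchange a b a′ b′)
    ; ⁻¹∈  = λ (a , b , a∈ , b∈ , g≈) →
        a ⁻¹ , b ⁻¹ , SX.⁻¹∈ a∈ , SY.⁻¹∈ b∈ ,
        trans (⁻¹-cong g≈) (sym (⁻¹-∙-comm a b))
    }
    where
    module SX = IsSubgroup SX
    module SY = IsSubgroup SY

  ⊙ˡ : ∀ {X Y} → IsSubgroup Y → X ⊆ X ⊙ Y
  ⊙ˡ SY {g} g∈ = g , ε , g∈ , IsSubgroup.ε∈ SY , sym (identityʳ g)

  ⊙ʳ : ∀ {X Y} → IsSubgroup X → Y ⊆ X ⊙ Y
  ⊙ʳ SX {g} g∈ = ε , g , IsSubgroup.ε∈ SX , g∈ , sym (identityˡ g)

  ⊙-min : ∀ {X Y T} → IsSubgroup T → X ⊆ T → Y ⊆ T → X ⊙ Y ⊆ T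
  ⊙-min ST X⊆ Y⊆ (_ , _ , a∈ , b∈ , g≈) =
    IsSubgroup.resp ST (sym g≈) (IsSubgroup.∙∈ ST (X⊆ a∈) (Y⊆ b∈))

  /-mono : ∀ {X Y g} → X ⊆ Y → g / X ⊆ g / Y
  /-mono X⊆Y (a , a∈ , k≈) = a , X⊆Y a∈ , k≈

  /-∈ : ∀ {X g a} → a ∈ X → g ∙ a ∈ g / X
  /-∈ a∈ = _ , a∈ , refl

  module Mod {X : Subset} (S : IsSubgroup X) where
    open IsSubgroup S

    infix 4 _~_
    _~_ : Rel Carrier (c ⊔ ℓ)
    k ~ g = k ∈ g / X

    ≈⇒~ : ∀ {k g} → k ≈ g → k ~ g
    ≈⇒~ e = ε , ε∈ , trans e (sym (identityʳ _))

    ~-refl : ∀ {g} → g ~ g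
    ~-refl = ≈⇒~ refl

    move : ∀ {k g a} → k ≈ g ∙ a → g ≈ k ∙ a ⁻¹
    move {k} {g} {a} e = sym (trans (∙-congʳ e) (trans (assoc g a (a ⁻¹))
      (trans (∙-congˡ (inverseʳ a)) (identityʳ g))))

    ~-sym : ∀ {k g} → k ~ g → g ~ k
    ~-sym (a , a∈ , e) = a ⁻¹ , ⁻¹∈ a∈ , move e

    ~-trans : ∀ {k g h} → k ~ g → g ~ h → k ~ h
    ~-trans (a , a∈ , e) (b , b∈ , e′) =
      b ∙ a , ∙∈ b∈ a∈ , trans e (trans (∙-congʳ e′) (assoc _ b a))

    ~-∙ : ∀ {k g k′ g′} → k ~ g → k′ ~ g′ → k ∙ k′ ~ g ∙ g′
    ~-∙ (a , a∈ , e) (b , b∈ , e′) =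
      a ∙ b , ∙∈ a∈ b∈ , trans (∙-cong e e′) (interchange _ a _ b)

    ~-⁻¹ : ∀ {k g} → k ~ g → k ⁻¹ ~ g ⁻¹
    ~-⁻¹ (a , a∈ , e) =
      a ⁻¹ , ⁻¹∈ a∈ , trans (⁻¹-cong e) (sym (⁻¹-∙-comm _ a))

    ∈⇒~ : ∀ {k g} → k ∈ X → g ∈ X → k ~ g
    ∈⇒~ {k} {g} k∈ g∈ = g ⁻¹ ∙ k , ∙∈ (⁻¹∈ g∈) k∈ ,
      sym (trans (sym (assoc g (g ⁻¹) k))
        (trans (∙-congʳ (inverseʳ g)) (identityˡ k)))

    ~-setoid : Setoid c (c ⊔ ℓ)
    ~-setoid = record
      { Carrier = Carrier ; _≈_ = _~_
      ; isEquivalence = record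
        { refl = ~-refl ; sym = ~-sym ; trans = ~-trans } }

    ⊆⇒~ : ∀ {k g} → k / X ⊆ g / X → k ~ g
    ⊆⇒~ sub = sub ~-refl

    ~⇒⊆ : ∀ {k g} → k ~ g → k / X ⊆ g / X
    ~⇒⊆ e e′ = ~-trans e′ e

    ~⇒≐ : ∀ {k g} → k ~ g → k / X ≐ g / X
    ~⇒≐ e = ~⇒⊆ e , ~⇒⊆ (~-sym e)

------------------------------------------------------------------------
-- Finite case analyses

all-I? : ∀ {ℓ} {Q : I → Set ℓ} → (∀ x → Dec (Q x)) → Dec (∀ x → Q x)
all-I? Q? = map′
  (λ { (a , b , c , d , e) → λ { p → a ; q → b ; r → c ; s → d ; t → e } })
  (λ Q → Q p , Q q , Q r , Q s , Q t)
  (Q? p ×-dec Q? q ×-dec Q? r ×-dec Q? s ×-dec Q? t)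

I→Fin : I → Fin 5
I→Fin p = 0F
I→Fin q = 1F
I→Fin r = 2F
I→Fin s = 3F
I→Fin t = 4F

I→Fin-injective : ∀ {x y} → I→Fin x ≡ I→Fin y → x ≡ y
I→Fin-injective {x} {y} = from-yes
  (all-I? λ x → all-I? λ y → (I→Fin x Fin.≟ I→Fin y) →-dec (x ≟ y)) x y

_≟ₖ_ : DecidableEquality Kind
positive ≟ₖ positive = yes ≡.refl
positive ≟ₖ negative = no λ ()
positive ≟ₖ neither  = no λ ()
negative ≟ₖ positive = no λ ()
negative ≟ₖ negative = yes ≡.refl
negative ≟ₖ neither  = no λ ()
neither  ≟ₖ positive = no λ ()
neither  ≟ₖ negative = no λ ()
neither  ≟ₖ neither  = yes ≡.refl

negate : Kind → Kind
negate positive = negative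
negate negative = positive
negate neither  = neither

kind-swapʳ : ∀ x y z → kind x z y ≡ negate (kind x y z)
kind-swapʳ = from-yes (all-I? λ x → all-I? λ y → all-I? λ z →
  kind x z y ≟ₖ negate (kind x y z))

kind-swapˡ : ∀ x y z → kind y x z ≡ negate (kind x y z)
kind-swapˡ = from-yes (all-I? λ x → all-I? λ y → all-I? λ z →
  kind y x z ≟ₖ negate (kind x y z))

kind-rotate : ∀ x y z → kind y z x ≡ kind x y z
kind-rotate = from-yes (all-I? λ x → all-I? λ y → all-I? λ z →
  kind y z x ≟ₖ kind x y z)

kind-xxz : ∀ x z → kind x x z ≡ neither
kind-xxz = from-yes (all-I? λ x → all-I? λ z → kind x x z ≟ₖ neither)

kind-xyx : ∀ x y → kind x y x ≡ neither
kind-xyx = from-yes (all-I? λ x → all-I? λ y → kind x y x ≟ₖ neither)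

kind-xyy : ∀ x y → kind x y y ≡ neither
kind-xyy = from-yes (all-I? λ x → all-I? λ y → kind x y y ≟ₖ neither)

_≟₃_ : DecidableEquality (I × I × I)
_≟₃_ = ≡-dec _≟_ (≡-dec _≟_ _≟_)

abstract
  permuted : ∀ x y z → kind x y z ≢ neither →
    (x , y , z) ≡ (p , q , r) ⊎ (x , y , z) ≡ (q , p , r) ⊎
    (x , y , z) ≡ (p , r , q) ⊎ (x , y , z) ≡ (r , p , q) ⊎
    (x , y , z) ≡ (q , r , p) ⊎ (x , y , z) ≡ (r , q , p)
  permuted = from-yes (all-I? λ x → all-I? λ y → all-I? λ z →
    ¬? (kind x y z ≟ₖ neither) →-dec
    (((x , y , z) ≟₃ (p , q , r)) ⊎-dec ((x , y , z) ≟₃ (q , p , r)) ⊎-dec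
    ((x , y , z) ≟₃ (p , r , q)) ⊎-dec ((x , y , z) ≟₃ (r , p , q)) ⊎-dec
    ((x , y , z) ≟₃ (q , r , p)) ⊎-dec ((x , y , z) ≟₃ (r , q , p))))

transpose-ˡ : ∀ {n} (i j : Fin n) → transpose i j ⟨$⟩ʳ i ≡ j
transpose-ˡ i j rewrite dec-true (i Fin.≟ i) ≡.refl = ≡.refl

transpose-ʳ : ∀ {n} (i j : Fin n) → transpose i j ⟨$⟩ʳ j ≡ i
transpose-ʳ i j with j Fin.≟ i
... | yes j≡i = j≡i
... | no  _ rewrite dec-true (j Fin.≟ j) ≡.refl = ≡.refl

transpose-≢ : ∀ {n} {i j k : Fin n} → k ≢ i → k ≢ j → transpose i j ⟨$⟩ʳ k ≡ k
transpose-≢ {i = i} {j} {k} k≢i k≢j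
  rewrite dec-false (k Fin.≟ i) k≢i | dec-false (k Fin.≟ j) k≢j = ≡.refl

abstract
  fourth : ∀ (i j k : Fin 4) → i ≢ j → i ≢ k → j ≢ k →
           ∃ λ l → ∀ m → m ≢ l → m ≡ i ⊎ m ≡ j ⊎ m ≡ k
  fourth = from-yes (Fin.all? {n = 4} λ i → Fin.all? {n = 4} λ j →
    Fin.all? {n = 4} λ k →
    ¬? (i Fin.≟ j) →-dec ¬? (i Fin.≟ k) →-dec ¬? (j Fin.≟ k) →-dec
    Fin.any? {n = 4} λ l → Fin.all? {n = 4} λ m → ¬? (m Fin.≟ l) →-dec
      ((m Fin.≟ i) ⊎-dec (m Fin.≟ j) ⊎-dec (m Fin.≟ k)))

------------------------------------------------------------------------
-- Verification of the polygroupoid axioms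

module LinesProperties {c ℓ} (𝔉 : AbelianGroup c ℓ) where
  private module F = AbelianGroup 𝔉
  open AbelianGroup (cube 𝔉)
  open Cosets (cube 𝔉)
  open CosetProperties (cube 𝔉)
  open Lines 𝔉
  open AbelianGroupProperties 𝔉 using (ε⁻¹≈ε)

  private
    εε : F.ε F.≈ F.ε F.∙ F.ε
    εε = F.sym (F.identityˡ F.ε)

    ε⁻ : F.ε F.⁻¹ F.≈ F.ε
    ε⁻ = ε⁻¹≈ε

  L-sub : ∀ m → IsSubgroup (L m)
  L-sub 0F = record
    { resp = λ e (a , x) → a , trans (sym e) x
    ; ε∈ = F.ε , refl
    ; ∙∈ = λ (a , x) (b , y) → a F.∙ b ,
        trans (∙-cong x y) (F.refl , F.sym εε , F.sym εε)
    ; ⁻¹∈ = λ (a , x) → a F.⁻¹ , trans (⁻¹-cong x) (F.refl , ε⁻ , ε⁻) }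
  L-sub 1F = record
    { resp = λ e (a , x) → a , trans (sym e) x
    ; ε∈ = F.ε , refl
    ; ∙∈ = λ (a , x) (b , y) → a F.∙ b ,
        trans (∙-cong x y) (F.sym εε , F.refl , F.sym εε)
    ; ⁻¹∈ = λ (a , x) → a F.⁻¹ , trans (⁻¹-cong x) (ε⁻ , F.refl , ε⁻) }
  L-sub 2F = record
    { resp = λ e (a , x) → a , trans (sym e) x
    ; ε∈ = F.ε , refl
    ; ∙∈ = λ (a , x) (b , y) → a F.∙ b ,
        trans (∙-cong x y) (F.sym εε , F.sym εε , F.refl)
    ; ⁻¹∈ = λ (a , x) → a F.⁻¹ , trans (⁻¹-cong x) (ε⁻ , ε⁻ , F.refl) }
  L-sub 3F = record
    { resp = λ e (a , x) → a , trans (sym e) x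
    ; ε∈ = F.ε , refl
    ; ∙∈ = λ (a , x) (b , y) → a F.∙ b , ∙-cong x y
    ; ⁻¹∈ = λ (a , x) → a F.⁻¹ , ⁻¹-cong x }

  -- Any three of the four lines generate the whole group.
  module _ {T : Subset} (ST : IsSubgroup T) where
    open IsSubgroup ST

    private
      cancel : ∀ a b → b F.≈ a F.∙ (a F.⁻¹ F.∙ b)
      cancel a b = F.sym (F.trans (F.sym (F.assoc a (a F.⁻¹) b))
        (F.trans (F.∙-congʳ (F.inverseʳ a)) (F.identityˡ b)))

      012⇒all : L 0F ⊆ T → L 1F ⊆ T → L 2F ⊆ T → ∀ g → g ∈ T
      012⇒all l0 l1 l2 (a , b , d) = resp
        ( F.trans (F.∙-congˡ (F.sym εε)) (F.identityʳ a)
        , F.trans (F.identityˡ _) (F.identityʳ b)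
        , F.trans (F.identityˡ _) (F.identityˡ d) )
        (∙∈ (l0 (a , refl)) (∙∈ (l1 (b , refl)) (l2 (d , refl))))

      123⇒0 : L 1F ⊆ T → L 2F ⊆ T → L 3F ⊆ T → L 0F ⊆ T
      123⇒0 l1 l2 l3 (a , x) = resp
        (sym (trans x
          ( F.sym (F.trans (F.∙-congˡ (F.sym εε)) (F.identityʳ a))
          , F.sym (F.trans (F.∙-congˡ (F.identityʳ _)) (F.inverseʳ a))
          , F.sym (F.trans (F.∙-congˡ (F.identityˡ _)) (F.inverseʳ a)))))
        (∙∈ (l3 (a , refl)) (∙∈ (l1 (a F.⁻¹ , refl)) (l2 (a F.⁻¹ , refl))))

      023⇒1 : L 0F ⊆ T → L 2F ⊆ T → L 3F ⊆ T → L 1F ⊆ T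
      023⇒1 l0 l2 l3 (a , x) = resp
        (sym (trans x
          ( F.sym (F.trans (F.∙-congˡ (F.identityʳ _)) (F.inverseʳ a))
          , F.sym (F.trans (F.∙-congˡ (F.sym εε)) (F.identityʳ a))
          , F.sym (F.trans (F.∙-congˡ (F.identityˡ _)) (F.inverseʳ a)))))
        (∙∈ (l3 (a , refl)) (∙∈ (l0 (a F.⁻¹ , refl)) (l2 (a F.⁻¹ , refl))))

      013⇒2 : L 0F ⊆ T → L 1F ⊆ T → L 3F ⊆ T → L 2F ⊆ T
      013⇒2 l0 l1 l3 (a , x) = resp
        (sym (trans x
          ( F.sym (F.trans (F.∙-congˡ (F.identityʳ _)) (F.inverseʳ a))
          , F.sym (F.trans (F.∙-congˡ (F.identityˡ _)) (F.inverseʳ a))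
          , F.sym (F.trans (F.∙-congˡ (F.sym εε)) (F.identityʳ a)))))
        (∙∈ (l3 (a , refl)) (∙∈ (l0 (a F.⁻¹ , refl)) (l1 (a F.⁻¹ , refl))))

    all-but-one⇒all : ∀ l → (∀ m → m ≢ l → L m ⊆ T) → ∀ g → g ∈ T
    all-but-one⇒all 0F ls = 012⇒all
      (123⇒0 (ls 1F λ ()) (ls 2F λ ()) (ls 3F λ ())) (ls 1F λ ()) (ls 2F λ ())
    all-but-one⇒all 1F ls = 012⇒all
      (ls 0F λ ()) (023⇒1 (ls 0F λ ()) (ls 2F λ ()) (ls 3F λ ())) (ls 2F λ ())
    all-but-one⇒all 2F ls = 012⇒all
      (ls 0F λ ()) (ls 1F λ ()) (013⇒2 (ls 0F λ ()) (ls 1F λ ()) (ls 3F λ ()))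
    all-but-one⇒all 3F ls = 012⇒all (ls 0F λ ()) (ls 1F λ ()) (ls 2F λ ())

module Rearrange {c ℓ} (𝔄 : AbelianGroup c ℓ) where
  open AbelianGroup 𝔄
  open CommutativeMonoidSolver commutativeMonoid

  ac₁ : ∀ g n c u v w →
        ((g ∙ n) ∙ c) ∙ ((u ∙ v) ∙ w) ≈ ((g ∙ (n ∙ v)) ∙ c) ∙ (u ∙ w)
  ac₁ = solve 6 (λ g n c u v w →
    ((g ⊕ n) ⊕ c) ⊕ ((u ⊕ v) ⊕ w) ⊜ ((g ⊕ (n ⊕ v)) ⊕ c) ⊕ (u ⊕ w)) refl

  ac₂ : ∀ k b c u v w →
        ((k ∙ b) ∙ c) ∙ ((u ∙ v) ∙ w) ≈ (((k ∙ u) ∙ b) ∙ c) ∙ (v ∙ w)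
  ac₂ = solve 6 (λ k b c u v w →
    ((k ⊕ b) ⊕ c) ⊕ ((u ⊕ v) ⊕ w) ⊜ (((k ⊕ u) ⊕ b) ⊕ c) ⊕ (v ⊕ w)) refl

  ac₃ : ∀ g a c b d → (((g ∙ a) ∙ c) ∙ b) ∙ d ≈ ((g ∙ a) ∙ b) ∙ (c ∙ d)
  ac₃ = solve 5 (λ g a c b d →
    (((g ⊕ a) ⊕ c) ⊕ b) ⊕ d ⊜ ((g ⊕ a) ⊕ b) ⊕ (c ⊕ d)) refl

  ac₄ : ∀ g a b c d → ((g ∙ a) ∙ b) ∙ (c ∙ d) ≈ (g ∙ ((a ∙ b) ∙ c)) ∙ d
  ac₄ = solve 5 (λ g a b c d →
    ((g ⊕ a) ⊕ b) ⊕ (c ⊕ d) ⊜ (g ⊕ ((a ⊕ b) ⊕ c)) ⊕ d) refl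

  ac₅ : ∀ g a c → (((g ∙ a) ∙ c) ∙ a ⁻¹) ∙ c ⁻¹ ≈ g
  ac₅ g a c = trans
    (solve 5 (λ g a c a′ c′ → (((g ⊕ a) ⊕ c) ⊕ a′) ⊕ c′ ⊜
                              (g ⊕ (a ⊕ a′)) ⊕ (c ⊕ c′)) refl g a c (a ⁻¹) (c ⁻¹))
    (trans (∙-cong (trans (∙-congˡ (inverseʳ a)) (identityʳ g)) (inverseʳ c))
           (identityʳ g))

  ac₆ : ∀ g a c → (g ⁻¹ ∙ ((g ∙ a) ∙ c)) ∙ c ⁻¹ ≈ a
  ac₆ g a c = trans
    (solve 5 (λ g a c g′ c′ → (g′ ⊕ ((g ⊕ a) ⊕ c)) ⊕ c′ ⊜
                              (a ⊕ (g ⊕ g′)) ⊕ (c ⊕ c′)) refl g a c (g ⁻¹) (c ⁻¹))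
    (trans (∙-cong (trans (∙-congˡ (inverseʳ g)) (identityʳ a)) (inverseʳ c))
           (identityʳ a))

module Verification {c ℓ} {𝔉 : AbelianGroup c ℓ} (S : ShiftedSystem 𝔉) where
  open AbelianGroup (cube 𝔉) renaming (Carrier to G; assoc to ∙-assoc)
  open AbelianGroupProperties (cube 𝔉) using (⁻¹-involutive; ε⁻¹≈ε)
  open Cosets (cube 𝔉)
  open CosetProperties (cube 𝔉)
  open Lines 𝔉
  open LinesProperties 𝔉
  open Rearrange (cube 𝔉)
  open ShiftedSystem S
  module Auto ρ = GroupMorphisms.IsGroupIsomorphism (α-auto ρ)

  section : I → Fin 4 → I
  section x m = proj₁ (line-onto x m)

  section≢ : ∀ x m → section x m ≢ x
  section≢ x m = proj₁ (proj₂ (line-onto x m))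

  line-section : ∀ x m → line x (section x m) ≡ m
  line-section x m = proj₂ (proj₂ (line-onto x m))

  -- By counting, the section of line x meets every index other than x.
  in-section : ∀ {x y} → y ≢ x → ¬ (∀ m → section x m ≢ y)
  in-section {x} {y} y≢x ∉ =
    Fin.<⇒notInjective (ℕ.n<1+n 5) λ e → injective _ _ (I→Fin-injective e)
    where
    enum : Fin 6 → I
    enum zero          = x
    enum (suc zero)    = y
    enum (suc (suc m)) = section x m
    injective : ∀ i j → enum i ≡ enum j → i ≡ j
    injective zero          zero          e = ≡.refl
    injective zero          (suc zero)    e = ⊥-elim (y≢x (≡.sym e))
    injective zero          (suc (suc n)) e = ⊥-elim (section≢ x n (≡.sym e))
    injective (suc zero)    zero          e = ⊥-elim (y≢x e)
    injective (suc zero)    (suc zero)    e = ≡.refl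
    injective (suc zero)    (suc (suc n)) e = ⊥-elim (∉ n (≡.sym e))
    injective (suc (suc m)) zero          e = ⊥-elim (section≢ x m e)
    injective (suc (suc m)) (suc zero)    e = ⊥-elim (∉ m e)
    injective (suc (suc m)) (suc (suc n)) e = ≡.cong (λ i → suc (suc i))
      (≡.trans (≡.sym (line-section x m))
               (≡.trans (≡.cong (line x) e) (line-section x n)))

  section-line : ∀ {x y} → y ≢ x → section x (line x y) ≡ y
  section-line {x} {y} y≢x = decidable-stable (section x (line x y) ≟ y)
    λ ≢y → in-section y≢x λ m e → ≢y
      (≡.trans (≡.cong (section x)
                 (≡.trans (≡.cong (line x) (≡.sym e)) (line-section x m))) e)

  line-injective : ∀ {x y z} → y ≢ x → z ≢ x → y ≢ z → line x y ≢ line x z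
  line-injective {x} y≢x z≢x y≢z e = y≢z
    (≡.trans (≡.sym (section-line y≢x))
             (≡.trans (≡.cong (section x) e) (section-line z≢x)))

  H-refl : ∀ x → H x x ≡ trivial
  H-refl x with x ≟ x
  ... | yes _  = ≡.refl
  ... | no x≢x = ⊥-elim (x≢x ≡.refl)

  H-≢ : ∀ {x y} → x ≢ y → H x y ≡ L (line x y)
  H-≢ {x} {y} x≢y with x ≟ y
  ... | yes x≡y = ⊥-elim (x≢y x≡y)
  ... | no  _   = ≡.refl

  H-refl⇒≈ε : ∀ x {a} → a ∈ H x x → a ≈ ε
  H-refl⇒≈ε x {a} a∈ = lower (≡.subst (a ∈_) (H-refl x) a∈)

  H⇒L : ∀ {x y} → x ≢ y → H x y ⊆ L (line x y)
  H⇒L x≢y {a} = ≡.subst (a ∈_) (H-≢ x≢y)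

  L⇒H : ∀ {x y} → x ≢ y → L (line x y) ⊆ H x y
  L⇒H x≢y {a} = ≡.subst (a ∈_) (≡.sym (H-≢ x≢y))

  H-sub : ∀ x y → IsSubgroup (H x y)
  H-sub x y with x ≟ y
  ... | yes _ = trivial-sub
  ... | no  _ = L-sub (line x y)

  module H x y = Mod (H-sub x y)

  αᵢ-refl : ∀ x g → αᵢ x x g ≡ g
  αᵢ-refl x g with x ≟ x
  ... | yes _  = ≡.refl
  ... | no x≢x = ⊥-elim (x≢x ≡.refl)

  αᵢ-≢ : ∀ {x y} → x ≢ y → ∀ g → αᵢ x y g ≡ α (π x y) g
  αᵢ-≢ {x} {y} x≢y g with x ≟ y
  ... | yes x≡y = ⊥-elim (x≢y x≡y)
  ... | no  _   = ≡.refl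

  αᵢ-cong : ∀ x y {g k} → g ≈ k → αᵢ x y g ≈ αᵢ x y k
  αᵢ-cong x y e with x ≟ y
  ... | yes _ = e
  ... | no  _ = Auto.⟦⟧-cong (π x y) e

  αᵢ-∙ : ∀ x y g k → αᵢ x y (g ∙ k) ≈ αᵢ x y g ∙ αᵢ x y k
  αᵢ-∙ x y g k with x ≟ y
  ... | yes _ = refl
  ... | no  _ = Auto.∙-homo (π x y) g k

  αᵢ-ε : ∀ x y → αᵢ x y ε ≈ ε
  αᵢ-ε x y with x ≟ y
  ... | yes _ = refl
  ... | no  _ = Auto.ε-homo (π x y)

  αᵢ-⁻¹ : ∀ x y g → αᵢ x y (g ⁻¹) ≈ αᵢ x y g ⁻¹
  αᵢ-⁻¹ x y g with x ≟ y
  ... | yes _ = refl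
  ... | no  _ = Auto.⁻¹-homo (π x y) g

  αᵢ-map : ∀ x y {X Y k g} → (∀ {a} → a ∈ X → αᵢ x y a ∈ Y) →
           k ∈ g / X → αᵢ x y k ∈ αᵢ x y g / Y
  αᵢ-map x y {g = g} X→Y (a , a∈ , e) =
    αᵢ x y a , X→Y a∈ , trans (αᵢ-cong x y e) (αᵢ-∙ x y g a)

  π-inverse : ∀ {x y} → x ≢ y → ∀ m → π y x ⟨$⟩ʳ (π x y ⟨$⟩ʳ m) ≡ m
  π-inverse {x} {y} x≢y m =
    ≡.subst (λ m → π y x ⟨$⟩ʳ (π x y ⟨$⟩ʳ m) ≡ m) (line-section x m)
      (go (section x m) (section≢ x m))
    where
    go : ∀ u → u ≢ x → π y x ⟨$⟩ʳ (π x y ⟨$⟩ʳ line x u) ≡ line x u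
    go u u≢x with u ≟ y
    ... | yes ≡.refl = ≡.trans (≡.cong (π y x ⟨$⟩ʳ_) (π-swap x≢y))
                               (π-swap (≢-sym x≢y))
    ... | no u≢y = ≡.trans (≡.cong (π y x ⟨$⟩ʳ_) (π-other x≢y u≢x u≢y))
                           (π-other (≢-sym x≢y) u≢y u≢x)

  αᵢ-inverse : ∀ x y g → αᵢ y x (αᵢ x y g) ≈ g
  αᵢ-inverse x y g with x ≟ y
  ... | yes ≡.refl = reflexive (αᵢ-refl x g)
  ... | no x≢y = trans (reflexive (αᵢ-≢ (≢-sym x≢y) _))
    (trans (α-∘ (π x y) (π y x) g) (trans (α-cong (π-inverse x≢y) g) (α-id g)))

  K : I → I → I → Subset
  K x y z = H x y ⊙ H x z

  K-sub : ∀ x y z → IsSubgroup (K x y z)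
  K-sub x y z = ⊙-sub (H-sub x y) (H-sub x z)

  module K x y z = Mod (K-sub x y z)

  Hˡ⊆K : ∀ x y z → H x y ⊆ K x y z
  Hˡ⊆K x y z = ⊙ˡ (H-sub x z)

  Hʳ⊆K : ∀ x y z → H x z ⊆ K x y z
  Hʳ⊆K x y z = ⊙ʳ (H-sub x y)

  K-comm : ∀ x y z → K x y z ⊆ K x z y
  K-comm x y z = ⊙-min (K-sub x z y) (Hʳ⊆K x z y) (Hˡ⊆K x z y)

  α-line⇒ : ∀ ρ {m n} → ρ ⟨$⟩ʳ m ≡ n → ∀ {a} → a ∈ L m → α ρ a ∈ L n
  α-line⇒ ρ ≡.refl a∈ = proj₁ (α-line ρ _) (_ , a∈ , refl)

  α-line⇐ : ∀ ρ {m n} → ρ ⟨$⟩ʳ m ≡ n → ∀ {b} → b ∈ L n →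
            ∃ λ a → a ∈ L m × b ≈ α ρ a
  α-line⇐ ρ ≡.refl b∈ = proj₂ (α-line ρ _) b∈

  αᵢ-swap : ∀ x y {a} → a ∈ H x y → αᵢ x y a ∈ H y x
  αᵢ-swap x y {a} a∈ = by (x ≟ y)
    where
    by : Dec (x ≡ y) → αᵢ x y a ∈ H y x
    by (yes ≡.refl) = ≡.subst (_∈ H x x) (≡.sym (αᵢ-refl x a)) a∈
    by (no x≢y) = L⇒H (≢-sym x≢y)
      (≡.subst (_∈ L (line y x)) (≡.sym (αᵢ-≢ x≢y a))
        (α-line⇒ (π x y) (π-swap x≢y) (H⇒L x≢y a∈)))

  αᵢ-H : ∀ x y z {b} → b ∈ H y z → αᵢ y x b ∈ K x y z
  αᵢ-H x y z {b} b∈ = by (x ≟ y) (y ≟ z) (x ≟ z)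
    where
    by : Dec (x ≡ y) → Dec (y ≡ z) → Dec (x ≡ z) → αᵢ y x b ∈ K x y z
    by (yes ≡.refl) _ _ =
      ≡.subst (_∈ K x x z) (≡.sym (αᵢ-refl x b)) (Hʳ⊆K x x z b∈)
    by (no _) (yes ≡.refl) _ = IsSubgroup.resp (K-sub x y y)
      (sym (trans (αᵢ-cong y x (H-refl⇒≈ε y b∈)) (αᵢ-ε y x)))
      (IsSubgroup.ε∈ (K-sub x y y))
    by (no _) (no _) (yes ≡.refl) = Hˡ⊆K x y x (αᵢ-swap y x b∈)
    by (no x≢y) (no y≢z) (no x≢z) = Hʳ⊆K x y z (L⇒H x≢z
      (≡.subst (_∈ L (line x z)) (≡.sym (αᵢ-≢ (≢-sym x≢y) b))
        (α-line⇒ (π y x) (π-other (≢-sym x≢y) (≢-sym y≢z) (≢-sym x≢z))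
          (H⇒L y≢z b∈))))

  αᵢ-H⁻¹ : ∀ x y z {v} → v ∈ H x z →
           ∃ λ v′ → v′ ∈ H y z × αᵢ y x v′ ∈ v / H x y
  αᵢ-H⁻¹ x y z {v} v∈ = by (x ≟ y) (y ≟ z) (x ≟ z)
    where
    by : Dec (x ≡ y) → Dec (y ≡ z) → Dec (x ≡ z) →
         ∃ λ v′ → v′ ∈ H y z × αᵢ y x v′ ∈ v / H x y
    by (yes ≡.refl) _ _ = v , v∈ , H.≈⇒~ x x (reflexive (αᵢ-refl x v))
    by (no _) (yes ≡.refl) _ =
      ε , IsSubgroup.ε∈ (H-sub y y) ,
      H.~-trans x y (H.≈⇒~ x y (αᵢ-ε y x))
        (H.∈⇒~ x y (IsSubgroup.ε∈ (H-sub x y)) v∈)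
    by (no _) (no _) (yes ≡.refl) =
      ε , IsSubgroup.ε∈ (H-sub y x) ,
      H.≈⇒~ x y (trans (αᵢ-ε y x) (sym (H-refl⇒≈ε x v∈)))
    by (no x≢y) (no y≢z) (no x≢z)
      with α-line⇐ (π y x) (π-other (≢-sym x≢y) (≢-sym y≢z) (≢-sym x≢z))
                   (H⇒L x≢z v∈)
    ... | v′ , v′∈ , e = v′ , L⇒H y≢z v′∈ ,
      H.≈⇒~ x y (trans (reflexive (αᵢ-≢ (≢-sym x≢y) v′)) (sym e))

  αᵢ-K : ∀ x y z {b} → b ∈ K y x z → αᵢ y x b ∈ K x y z
  αᵢ-K x y z (a , b , a∈ , b∈ , e) = IsSubgroup.resp (K-sub x y z)
    (sym (trans (αᵢ-cong y x e) (αᵢ-∙ y x a b)))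
    (IsSubgroup.∙∈ (K-sub x y z) (Hˡ⊆K x y z (αᵢ-swap y x a∈)) (αᵢ-H x y z b∈))

  -- A transposition changes elements only within its two lines.
  module _ {m n : Fin 4} (m≢n : m ≢ n) where
    private
      τ = transpose m n
      LL-sub = ⊙-sub (L-sub m) (L-sub n)
      module LL = Mod LL-sub

      T : Subset
      T g = α τ g LL.~ g

      T-sub : IsSubgroup T
      T-sub = record
        { resp = λ e t∈ → LL.~-trans (LL.≈⇒~ (Auto.⟦⟧-cong τ (sym e)))
                            (LL.~-trans t∈ (LL.≈⇒~ e))
        ; ε∈   = LL.≈⇒~ (Auto.ε-homo τ)
        ; ∙∈   = λ a∈ b∈ → LL.~-trans (LL.≈⇒~ (Auto.∙-homo τ _ _))
                                      (LL.~-∙ a∈ b∈)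
        ; ⁻¹∈  = λ a∈ → LL.~-trans (LL.≈⇒~ (Auto.⁻¹-homo τ _)) (LL.~-⁻¹ a∈)
        }

      L⊆T : ∀ k → L k ⊆ T
      L⊆T k a∈ with m Fin.≟ k | n Fin.≟ k
      ... | yes ≡.refl | _ = LL.∈⇒~
        (⊙ʳ (L-sub m) (α-line⇒ τ (transpose-ˡ m n) a∈)) (⊙ˡ (L-sub n) a∈)
      ... | no _ | yes ≡.refl = LL.∈⇒~
        (⊙ˡ (L-sub n) (α-line⇒ τ (transpose-ʳ m n) a∈)) (⊙ʳ (L-sub m) a∈)
      ... | no m≢k | no n≢k = LL.≈⇒~ (α-transpose m≢n m≢k n≢k a∈)

    α-transpose~ : ∀ g → α τ g ∈ g / L m ⊙ L n
    α-transpose~ = all-but-one⇒all T-sub 0F λ k _ → L⊆T k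

  π-triangle : ∀ {x y z} → x ≢ y → y ≢ z → x ≢ z →
    (π z y ∘ₚ π y x) Perm.≈ (π z x ∘ₚ transpose (line x y) (line x z))
  π-triangle {x} {y} {z} x≢y y≢z x≢z m = ≡.subst (λ m →
      (π z y ∘ₚ π y x) ⟨$⟩ʳ m ≡
      (π z x ∘ₚ transpose (line x y) (line x z)) ⟨$⟩ʳ m)
    (line-section z m) (go (section z m) (section≢ z m))
    where
    τ = transpose (line x y) (line x z)
    go : ∀ u → u ≢ z → π y x ⟨$⟩ʳ (π z y ⟨$⟩ʳ line z u) ≡
                       τ ⟨$⟩ʳ (π z x ⟨$⟩ʳ line z u)
    go u u≢z with u ≟ y | u ≟ x
    ... | yes ≡.refl | _ =
      ≡.trans (≡.cong (π y x ⟨$⟩ʳ_) (π-swap (≢-sym y≢z)))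
      (≡.trans (π-other (≢-sym x≢y) (≢-sym y≢z) (≢-sym x≢z))
      (≡.sym (≡.trans (≡.cong (τ ⟨$⟩ʳ_)
                        (π-other (≢-sym x≢z) u≢z (≢-sym x≢y)))
                      (transpose-ˡ (line x y) (line x z)))))
    ... | no _ | yes ≡.refl =
      ≡.trans (≡.cong (π y x ⟨$⟩ʳ_) (π-other (≢-sym y≢z) x≢z x≢y))
      (≡.trans (π-swap (≢-sym x≢y))
      (≡.sym (≡.trans (≡.cong (τ ⟨$⟩ʳ_) (π-swap (≢-sym x≢z)))
                      (transpose-ʳ (line x y) (line x z)))))
    ... | no u≢y | no u≢x =
      ≡.trans (≡.cong (π y x ⟨$⟩ʳ_) (π-other (≢-sym y≢z) u≢z u≢y))
      (≡.trans (π-other (≢-sym x≢y) u≢y u≢x)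
      (≡.sym (≡.trans (≡.cong (τ ⟨$⟩ʳ_) (π-other (≢-sym x≢z) u≢z u≢x))
                      (transpose-≢
                        (line-injective u≢x (≢-sym x≢y) u≢y)
                        (line-injective u≢x (≢-sym x≢z) u≢z)))))

  αᵢ-triangle : ∀ x y z g → αᵢ y x (αᵢ z y g) ∈ αᵢ z x g / K x y z
  αᵢ-triangle x y z g = by (x ≟ y) (y ≟ z) (x ≟ z)
    where
    by : Dec (x ≡ y) → Dec (y ≡ z) → Dec (x ≡ z) →
         αᵢ y x (αᵢ z y g) ∈ αᵢ z x g / K x y z
    by (yes ≡.refl) _ _ = K.≈⇒~ x x z (reflexive (αᵢ-refl x _))
    by (no _) (yes ≡.refl) _ =
      K.≈⇒~ x y y (αᵢ-cong y x (reflexive (αᵢ-refl y g)))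
    by (no _) (no _) (yes ≡.refl) =
      K.≈⇒~ x y x (trans (αᵢ-inverse x y g) (sym (reflexive (αᵢ-refl x g))))
    by (no x≢y) (no y≢z) (no x≢z) = K.~-trans x y z
      (K.≈⇒~ x y z (trans (reflexive (≡.trans
          (≡.cong (αᵢ y x) (αᵢ-≢ (≢-sym y≢z) g)) (αᵢ-≢ (≢-sym x≢y) _)))
        (trans (α-∘ (π z y) (π y x) g)
        (trans (α-cong (π-triangle x≢y y≢z x≢z) g)
               (sym (α-∘ (π z x) (transpose (line x y) (line x z)) g))))))
      (K.~-trans x y z
        (/-mono (⊙-min (K-sub x y z) (λ a∈ → Hˡ⊆K x y z (L⇒H x≢y a∈))
                                     (λ a∈ → Hʳ⊆K x y z (L⇒H x≢z a∈)))
          (α-transpose~ (line-injective (≢-sym x≢y) (≢-sym x≢z) y≢z)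
            (α (π z x) g)))
        (K.≈⇒~ x y z (reflexive (≡.sym (αᵢ-≢ (≢-sym x≢z) g)))))

  signed : Kind → G → G
  signed positive g = g
  signed negative g = g ⁻¹
  signed neither  g = ε

  shift : I → I → I → G
  shift x y z = signed (kind x y z) (fᵢ x)

  C⇔shift : ∀ x y z → C x y z ≐ shift x y z / K x y z
  C⇔shift x y z with kind x y z
  ... | positive = (λ k∈ → k∈) , (λ k∈ → k∈)
  ... | negative = (λ k∈ → k∈) , (λ k∈ → k∈)
  ... | neither  = (λ k∈ → _ , k∈ , sym (identityˡ _)) ,
    (λ (_ , k∈ , e) →
      IsSubgroup.resp (K-sub x y z) (sym (trans e (identityˡ _))) k∈)

  signed-negate : ∀ κ g → signed (negate κ) g ≈ signed κ g ⁻¹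
  signed-negate positive g = refl
  signed-negate negative g = sym (⁻¹-involutive g)
  signed-negate neither  g = sym ε⁻¹≈ε

  f-compat : ∀ x y z → kind x y z ≢ neither →
             αᵢ y x (fᵢ y) ∈ fᵢ x / K x y z
  f-compat x y z ≢n with permuted x y z ≢n
  ... | inj₁ ≡.refl = K.≈⇒~ p q r (αᵢ-inverse p q f)
  ... | inj₂ (inj₁ ≡.refl) = K.~-refl q p r
  ... | inj₂ (inj₂ (inj₁ ≡.refl)) = K.≈⇒~ p r q (αᵢ-inverse p r f)
  ... | inj₂ (inj₂ (inj₂ (inj₁ ≡.refl))) = K.~-refl r p q
  ... | inj₂ (inj₂ (inj₂ (inj₂ (inj₁ ≡.refl)))) = αᵢ-triangle q r p f
  ... | inj₂ (inj₂ (inj₂ (inj₂ (inj₂ ≡.refl)))) = αᵢ-triangle r q p f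

  αᵢ-signed : ∀ x y κ g → αᵢ x y (signed κ g) ≈ signed κ (αᵢ x y g)
  αᵢ-signed x y positive g = refl
  αᵢ-signed x y negative g = αᵢ-⁻¹ x y g
  αᵢ-signed x y neither  g = αᵢ-ε x y

  αᵢ-signed-fᵢ : ∀ x y z κ → (κ ≢ neither → kind x y z ≢ neither) →
                 αᵢ y x (signed κ (fᵢ y)) ∈ signed κ (fᵢ x) / K x y z
  αᵢ-signed-fᵢ x y z positive ≢n = f-compat x y z (≢n λ ())
  αᵢ-signed-fᵢ x y z negative ≢n =
    K.~-trans x y z (K.≈⇒~ x y z (αᵢ-⁻¹ y x _))
                    (K.~-⁻¹ x y z (f-compat x y z (≢n λ ())))
  αᵢ-signed-fᵢ x y z neither  _  = K.≈⇒~ x y z (αᵢ-ε y x)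

  shift-swapʳ : ∀ x y z → shift x z y ≈ shift x y z ⁻¹
  shift-swapʳ x y z = trans
    (reflexive (≡.cong (λ κ → signed κ (fᵢ x)) (kind-swapʳ x y z)))
    (signed-negate (kind x y z) (fᵢ x))

  shift-rotate : ∀ x y z → αᵢ y x (shift y z x) ∈ shift x y z / K x y z
  shift-rotate x y z = K.~-trans x y z
    (K.≈⇒~ x y z (αᵢ-cong y x (reflexive
      (≡.cong (λ κ → signed κ (fᵢ y)) (kind-rotate x y z)))))
    (αᵢ-signed-fᵢ x y z (kind x y z) λ ≢n → ≢n)

  shift-swapˡ : ∀ x y z → αᵢ y x (shift y x z) ∈ shift x y z ⁻¹ / K x y z
  shift-swapˡ x y z = K.~-trans x y z
    (K.≈⇒~ x y z (trans (αᵢ-cong y x (shift-swapʳ y z x)) (αᵢ-⁻¹ y x _)))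
    (K.~-⁻¹ x y z (shift-rotate x y z))

  shift-neither : ∀ x y z → kind x y z ≡ neither → shift x y z ≈ ε
  shift-neither x y z e = reflexive (≡.cong (λ κ → signed κ (fᵢ x)) e)

  shift-xxz : ∀ x z → shift x x z ≈ ε
  shift-xxz x z = shift-neither x x z (kind-xxz x z)

  shift-xyx : ∀ x y → shift x y x ≈ ε
  shift-xyx x y = shift-neither x y x (kind-xyx x y)

  shift-xyy : ∀ x y → shift x y y ≈ ε
  shift-xyy x y = shift-neither x y y (kind-xyy x y)

  T : I → I → I → I → Subset
  T x y z w = K x y z ⊙ H x w

  T-sub : ∀ x y z w → IsSubgroup (T x y z w)
  T-sub x y z w = ⊙-sub (K-sub x y z) (H-sub x w)

  module T x y z w = Mod (T-sub x y z w)

  Kyz⊆T : ∀ x y z w → K x y z ⊆ T x y z w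
  Kyz⊆T x y z w = ⊙ˡ (H-sub x w)

  Hw⊆T : ∀ x y z w → H x w ⊆ T x y z w
  Hw⊆T x y z w = ⊙ʳ (K-sub x y z)

  Kyw⊆T : ∀ x y z w → K x y w ⊆ T x y z w
  Kyw⊆T x y z w = ⊙-min (T-sub x y z w)
    (λ a∈ → Kyz⊆T x y z w (Hˡ⊆K x y z a∈)) (Hw⊆T x y z w)

  Kzw⊆T : ∀ x y z w → K x z w ⊆ T x y z w
  Kzw⊆T x y z w = ⊙-min (T-sub x y z w)
    (λ a∈ → Kyz⊆T x y z w (Hʳ⊆K x y z a∈)) (Hw⊆T x y z w)

  T-full : ∀ {x y z w} → x ≢ y → x ≢ z → x ≢ w → y ≢ z → y ≢ w → z ≢ w →
           ∀ g → g ∈ T x y z w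
  T-full {x} {y} {z} {w} x≢y x≢z x≢w y≢z y≢w z≢w =
    all-but-one⇒all (T-sub x y z w) (proj₁ others) λ m m≢l →
      by (proj₂ others m m≢l)
    where
    others : ∃ λ l → ∀ m → m ≢ l →
             m ≡ line x y ⊎ m ≡ line x z ⊎ m ≡ line x w
    others = fourth (line x y) (line x z) (line x w)
      (line-injective (≢-sym x≢y) (≢-sym x≢z) y≢z)
      (line-injective (≢-sym x≢y) (≢-sym x≢w) y≢w)
      (line-injective (≢-sym x≢z) (≢-sym x≢w) z≢w)
    by : ∀ {m} → m ≡ line x y ⊎ m ≡ line x z ⊎ m ≡ line x w → L m ⊆ T x y z w
    by (inj₁ ≡.refl) a∈ = Kyz⊆T x y z w (Hˡ⊆K x y z (L⇒H x≢y a∈))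
    by (inj₂ (inj₁ ≡.refl)) a∈ = Kyz⊆T x y z w (Hʳ⊆K x y z (L⇒H x≢z a∈))
    by (inj₂ (inj₂ ≡.refl)) a∈ = Hw⊆T x y z w (L⇒H x≢w a∈)

  shift-cocycle : ∀ x y z w →
    shift x y z ∙ shift x z w ∈ αᵢ y x (shift y z w) ∙ shift x y w / T x y z w
  shift-cocycle x y z w =
    by (x ≟ y) (y ≟ z) (z ≟ w) (x ≟ z) (y ≟ w) (x ≟ w)
    where
    module M = T x y z w
    by : Dec (x ≡ y) → Dec (y ≡ z) → Dec (z ≡ w) →
         Dec (x ≡ z) → Dec (y ≡ w) → Dec (x ≡ w) →
         shift x y z ∙ shift x z w ∈
         αᵢ y x (shift y z w) ∙ shift x y w / T x y z w
    by (yes ≡.refl) _ _ _ _ _ = M.≈⇒~ (trans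
      (∙-congʳ (shift-xxz x z)) (trans (comm ε _)
      (sym (∙-cong (reflexive (αᵢ-refl x _)) (shift-xxz x w)))))
    by _ (yes ≡.refl) _ _ _ _ = M.≈⇒~ (∙-congʳ
      (trans (shift-xyy x y)
        (sym (trans (αᵢ-cong y x (shift-xxz y w)) (αᵢ-ε y x)))))
    by _ _ (yes ≡.refl) _ _ _ = M.≈⇒~ (trans
      (∙-congˡ (shift-xyy x z)) (trans (comm _ ε)
      (sym (∙-congʳ (trans (αᵢ-cong y x (shift-xyy y z)) (αᵢ-ε y x))))))
    by _ _ _ (yes ≡.refl) _ _ = M.~-trans
      (M.≈⇒~ (trans (∙-cong (shift-xyx x y) (shift-xxz x w))
        (trans (identityˡ ε) (sym (inverseˡ (shift x y w))))))
      (M.~-∙ (M.~-sym (/-mono (Kyw⊆T x y x w) (shift-swapˡ x y w))) M.~-refl)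
    by _ _ _ _ (yes ≡.refl) _ = M.≈⇒~ (trans
      (trans (∙-congˡ (shift-swapʳ x y z)) (inverseʳ (shift x y z)))
      (sym (trans (∙-cong (trans (αᵢ-cong y x (shift-xyx y z)) (αᵢ-ε y x))
                          (shift-xyy x y)) (identityˡ ε))))
    by _ _ _ _ _ (yes ≡.refl) = M.~-∙
      (M.~-sym (/-mono (Kyz⊆T x y z x) (shift-rotate x y z)))
      (M.≈⇒~ (trans (shift-xyx x z) (sym (shift-xyx x y))))
    by (no x≢y) (no y≢z) (no z≢w) (no x≢z) (no y≢w) (no x≢w) =
      M.∈⇒~ (full _) (full _)
      where full = T-full x≢y x≢z x≢w y≢z y≢w z≢w

  -- The product of (x , g , y) and (y , h , z) is the set of (x , k , z)
  -- with k in result x y z g h / K x y z.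
  result : I → I → I → G → G → G
  result x y z g h = (g ∙ αᵢ y x h) ∙ shift x y z

  product⇒ : ∀ x y z {g h k} →
    k / H x z ⊆ φ y x (φ x y (g / H x y) ⊙ (h / H y z)) ⊙ C x y z →
    k ∈ result x y z g h / K x y z
  product⇒ x y z {g} {h} {k} sub with sub (H.~-refl x z)
  ... | u , v , (g₁ , g₁⊆ , u∈) , v∈ , k≈uv with g₁⊆ (H.~-refl y x)
  ... | a , b , (g₂ , g₂⊆ , a∈) , b∈ , g₁≈ab =
    M.~-trans (M.≈⇒~ k≈uv) (M.~-∙ u~ (proj₁ (C⇔shift x y z) v∈))
    where
    module M = K x y z
    a~ : a ∈ αᵢ x y g / H y x
    a~ = H.~-trans y x a∈ (αᵢ-map x y (αᵢ-swap x y) (g₂⊆ (H.~-refl x y)))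
    αa~ : αᵢ y x a ∈ g / H x y
    αa~ = H.~-trans x y (αᵢ-map y x (αᵢ-swap y x) a~)
                        (H.≈⇒~ x y (αᵢ-inverse x y g))
    u~ : u ∈ g ∙ αᵢ y x h / K x y z
    u~ = M.~-trans (/-mono (Hˡ⊆K x y z) u∈)
      (M.~-trans (M.≈⇒~ (trans (αᵢ-cong y x g₁≈ab) (αᵢ-∙ y x a b)))
        (M.~-∙ (/-mono (Hˡ⊆K x y z) αa~) (αᵢ-map y x (αᵢ-H x y z) b∈)))

  product⇐ : ∀ x y z {g h k} → k ∈ result x y z g h / K x y z →
    k / H x z ⊆ φ y x (φ x y (g / H x y) ⊙ (h / H y z)) ⊙ C x y z
  product⇐ x y z {g} {h} {k} k~ {k′} k′~
    with K.~-trans x y z (/-mono (Hʳ⊆K x y z) k′~) k~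
  ... | κ , κ∈ , k′≈ =
    g ∙ αᵢ y x h , shift x y z ∙ κ ,
    (αᵢ x y g ∙ h , φ⊆ , H.≈⇒~ x y (sym (trans (αᵢ-∙ y x _ h)
                                          (∙-congʳ (αᵢ-inverse x y g))))) ,
    proj₂ (C⇔shift x y z) (/-∈ κ∈) ,
    trans k′≈ (∙-assoc _ _ κ)
    where
    φ⊆ : αᵢ x y g ∙ h / H y x ⊆ φ x y (g / H x y) ⊙ (h / H y z)
    φ⊆ (b , b∈ , e) = αᵢ x y g ∙ b , h , (g , (λ g∈ → g∈) , /-∈ b∈) ,
      H.~-refl y z , trans e (trans (∙-assoc _ h b)
        (trans (∙-congˡ (comm h b)) (sym (∙-assoc _ b h))))

  result-cong : ∀ x y z {g g′ h h′} → g ∈ g′ / H x y → h ∈ h′ / H y z →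
                result x y z g h ∈ result x y z g′ h′ / K x y z
  result-cong x y z g~ h~ = M.~-∙ (M.~-∙ (/-mono (Hˡ⊆K x y z) g~)
    (αᵢ-map y x (αᵢ-H x y z) h~)) M.~-refl
    where module M = K x y z

  result-assoc : ∀ x y z w g h l →
    result x z w (result x y z g h) l ∈
    result x y w g (result y z w h l) / T x y z w
  result-assoc x y z w g h l = M.~-trans (M.≈⇒~ (ac₃ _ _ _ _ _))
    (M.~-trans
      (M.~-∙ (M.~-∙ M.~-refl (M.~-sym (/-mono (Kyz⊆T x y z w)
                                        (αᵢ-triangle x y z l))))
             (shift-cocycle x y z w))
      (M.≈⇒~ (trans (ac₄ _ _ _ _ _) (∙-congʳ (∙-congˡ
        (sym (trans (αᵢ-∙ y x _ _) (∙-congʳ (αᵢ-∙ y x _ _)))))))))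
    where module M = T x y z w

  assoc⇒ : ∀ x y z w {g h l k m} → k ∈ result x y z g h / K x y z →
    m ∈ result x z w k l / K x z w →
    ∃ λ n → n ∈ result y z w h l / K y z w × m ∈ result x y w g n / K x y w
  assoc⇒ x y z w {g} {h} {l} {k} {m} k~ m~ = go m~n₀
    where
    module M = T x y z w
    module N = K x y w
    n₀ = result y z w h l
    m~n₀ : m ∈ result x y w g n₀ / T x y z w
    m~n₀ = M.~-trans (/-mono (Kzw⊆T x y z w) m~) (M.~-trans
      (M.~-∙ (M.~-∙ (/-mono (Kyz⊆T x y z w) k~) M.~-refl) M.~-refl)
      (result-assoc x y z w g h l))
    go : m ∈ result x y w g n₀ / T x y z w →
         ∃ λ n → n ∈ n₀ / K y z w × m ∈ result x y w g n / K x y w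
    go (_ , (_ , v″ , (u , v , u∈ , v∈ , uv≈) , v″∈ , e) , m≈)
      with αᵢ-H⁻¹ x y z v∈
    ... | v′ , v′∈ , v′~ = n₀ ∙ v′ , /-∈ (Hˡ⊆K y z w v′∈) ,
      N.~-trans
        (u ∙ v″ , (u , v″ , u∈ , v″∈ , refl) ,
         trans m≈ (trans (∙-congˡ (trans e (∙-congʳ uv≈)))
                         (ac₁ g _ _ u v v″)))
        (N.~-∙ (N.~-∙ N.~-refl (N.~-trans
          (N.~-∙ N.~-refl (N.~-sym (/-mono (Hˡ⊆K x y w) v′~)))
          (N.≈⇒~ (sym (αᵢ-∙ y x n₀ v′))))) N.~-refl)

  assoc⇐ : ∀ x y z w {g h l n m} → n ∈ result y z w h l / K y z w →
    m ∈ result x y w g n / K x y w →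
    ∃ λ k → k ∈ result x y z g h / K x y z × m ∈ result x z w k l / K x z w
  assoc⇐ x y z w {g} {h} {l} {n} {m} n~ m~ = go m~k₀
    where
    module M = T x y z w
    k₀ = result x y z g h
    lift⊆ : ∀ {a} → a ∈ K y z w → αᵢ y x a ∈ T x y z w
    lift⊆ (a , b , a∈ , b∈ , e) = IsSubgroup.resp (T-sub x y z w)
      (sym (trans (αᵢ-cong y x e) (αᵢ-∙ y x a b)))
      (IsSubgroup.∙∈ (T-sub x y z w)
        (Kyz⊆T x y z w (αᵢ-H x y z a∈)) (Kyw⊆T x y z w (αᵢ-H x y w b∈)))
    m~k₀ : m ∈ result x z w k₀ l / T x y z w
    m~k₀ = M.~-trans (/-mono (Kyw⊆T x y z w) m~) (M.~-trans
      (M.~-∙ (M.~-∙ M.~-refl (αᵢ-map y x lift⊆ n~)) M.~-refl)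
      (M.~-sym (result-assoc x y z w g h l)))
    go : m ∈ result x z w k₀ l / T x y z w →
         ∃ λ k → k ∈ k₀ / K x y z × m ∈ result x z w k l / K x z w
    go (_ , (_ , v″ , (u , v , u∈ , v∈ , uv≈) , v″∈ , e) , m≈) =
      k₀ ∙ u , /-∈ (Hˡ⊆K x y z u∈) ,
      (v ∙ v″ , (v , v″ , v∈ , v″∈ , refl) ,
       trans m≈ (trans (∙-congˡ (trans e (∙-congʳ uv≈)))
                       (ac₂ k₀ _ _ u v v″)))

  product : ∀ {x y z g h k} → k ∈ result x y z g h / K x y z →
            (x , k , z) ∈ (x , g , y) ∘ₚᵣ (y , h , z)
  product {x} {y} {z} k~ = ≡.refl , ≡.refl , ≡.refl , product⇐ x y z k~

  ≈ₚ-setoid : Setoid c (c ⊔ ℓ)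
  ≈ₚ-setoid = record
    { Carrier = P
    ; _≈_     = _≈ₚ_
    ; isEquivalence = record
      { refl  = ≡.refl , ≡.refl , (λ k∈ → k∈) , (λ k∈ → k∈)
      ; sym   = λ { (≡.refl , ≡.refl , to , from) →
                    ≡.refl , ≡.refl , from , to }
      ; trans = λ { (≡.refl , ≡.refl , to , from)
                    (≡.refl , ≡.refl , to′ , from′) →
                    ≡.refl , ≡.refl ,
                    (λ k∈ → to′ (to k∈)) , (λ k∈ → from (from′ k∈)) }
      }
    }

  ≈ₚ-refl : ∀ {a} → a ≈ₚ a
  ≈ₚ-refl = ≡.refl , ≡.refl , (λ k∈ → k∈) , (λ k∈ → k∈)

  ∘-resp : ∀ {a a′ b b′ d d′} → a ≈ₚ a′ → b ≈ₚ b′ → d ≈ₚ d′ →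
           d ∈ a ∘ₚᵣ b → d′ ∈ a′ ∘ₚᵣ b′
  ∘-resp {x , _ , y} {b = _ , _ , z}
         (≡.refl , ≡.refl , g⊆ , _) (≡.refl , ≡.refl , h⊆ , _)
         (≡.refl , ≡.refl , _ , k⊇) (≡.refl , ≡.refl , ≡.refl , sub) =
    product (M.~-trans (/-mono (Hʳ⊆K x y z) (k⊇ (H.~-refl x z)))
      (M.~-trans (product⇒ x y z sub)
        (result-cong x y z (g⊆ (H.~-refl x y)) (h⊆ (H.~-refl y z)))))
    where module M = K x y z

  invₚ-cong : ∀ {a a′} → a ≈ₚ a′ → invₚ a ≈ₚ invₚ a′
  invₚ-cong {x , _ , y} (≡.refl , ≡.refl , g⊆ , _) = ≡.refl , ≡.refl ,
    H.~⇒≐ y x (αᵢ-map x y (αᵢ-swap x y) (H.~-⁻¹ x y (g⊆ (H.~-refl x y))))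

  K-xyy : ∀ x y → K x y y ⊆ H x y
  K-xyy x y = ⊙-min (H-sub x y) (λ a∈ → a∈) (λ a∈ → a∈)

  K-xxy : ∀ x y → K x x y ⊆ H x y
  K-xxy x y = ⊙-min (H-sub x y)
    (λ a∈ → IsSubgroup.resp (H-sub x y) (sym (H-refl⇒≈ε x a∈))
              (IsSubgroup.ε∈ (H-sub x y)))
    (λ a∈ → a∈)

  result-εʳ : ∀ x y g → result x y y g ε ≈ g
  result-εʳ x y g = trans (∙-cong (∙-congˡ (αᵢ-ε y x)) (shift-xyy x y))
    (trans (identityʳ _) (identityʳ g))

  result-εˡ : ∀ x y g → result x x y ε g ≈ g
  result-εˡ x y g = trans
    (∙-cong (trans (identityˡ _) (reflexive (αᵢ-refl x g))) (shift-xxz x y))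
    (identityʳ g)

  rotate₁ : ∀ x y z {g h k} → k ∈ result x y z g h / K x y z →
            g ∈ result x z y k (αᵢ y z (h ⁻¹)) / K x z y
  rotate₁ x y z {g} {h} {k} k~ = M.~-sym (M.~-trans
    (M.~-∙ (M.~-∙ (/-mono (K-comm x y z) k~)
        (M.~-trans (αᵢ-triangle x z y (h ⁻¹)) (M.≈⇒~ (αᵢ-⁻¹ y x h))))
      (M.≈⇒~ (shift-swapʳ x y z)))
    (M.≈⇒~ (ac₅ g (αᵢ y x h) (shift x y z))))
    where module M = K x z y

  rotate₂ : ∀ x y z {g h k} → k ∈ result x y z g h / K x y z →
            h ∈ result y x z (αᵢ x y (g ⁻¹)) k / K y x z
  rotate₂ x y z {g} {h} {k} k~ = M.~-sym (M.~-trans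
    (M.~-∙ (M.~-∙ (M.≈⇒~ (αᵢ-⁻¹ x y g)) αk~)
           (M.≈⇒~ (sym (⁻¹-involutive (shift y x z)))))
    (M.≈⇒~ (ac₆ (αᵢ x y g) h (shift y x z ⁻¹))))
    where
    module M = K y x z
    αk~ : αᵢ x y k ∈ (αᵢ x y g ∙ h) ∙ shift y x z ⁻¹ / K y x z
    αk~ = M.~-trans (αᵢ-map x y (αᵢ-K y x z) k~) (M.~-trans
      (M.≈⇒~ (trans (αᵢ-∙ x y _ _) (∙-congʳ (trans (αᵢ-∙ x y g _)
        (∙-congˡ (αᵢ-inverse y x h))))))
      (M.~-∙ M.~-refl (shift-swapˡ y x z)))

  inverse-twice : ∀ x y g → αᵢ y x (αᵢ x y (g ⁻¹) ⁻¹) ≈ g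
  inverse-twice x y g = trans
    (αᵢ-cong y x (trans (⁻¹-cong (αᵢ-⁻¹ x y g)) (⁻¹-involutive _)))
    (αᵢ-inverse x y g)

  _∘⊙_ : Pred P (c ⊔ ℓ) → Pred P (c ⊔ ℓ) → Pred P (c ⊔ ℓ)
  (X ∘⊙ Y) d = ∃₂ λ a b → a ∈ X × b ∈ Y × d ∈ a ∘ₚᵣ b

  assocₚ : ∀ a b d → ((a ∘ₚᵣ b) ∘⊙ (d ≈ₚ_)) ≐ ((a ≈ₚ_) ∘⊙ (b ∘ₚᵣ d))
  assocₚ (x , g , y) (y₁ , h , z) (z₁ , l , w) = to , from
    where
    to : (((x , g , y) ∘ₚᵣ (y₁ , h , z)) ∘⊙ ((z₁ , l , w) ≈ₚ_)) ⊆
         (((x , g , y) ≈ₚ_) ∘⊙ ((y₁ , h , z) ∘ₚᵣ (z₁ , l , w)))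
    to {_ , m , _}
       ((_ , k , _) , (_ , l′ , _) , (≡.refl , ≡.refl , ≡.refl , k∈) ,
        (≡.refl , ≡.refl , _ , l⊇) , (≡.refl , ≡.refl , ≡.refl , m∈)) =
      (x , g , y) , (y , proj₁ n , w) , ≈ₚ-refl ,
      product (proj₁ (proj₂ n)) , product (proj₂ (proj₂ n))
      where
      n : ∃ λ n → n ∈ result y z w h l / K y z w ×
                  m ∈ result x y w g n / K x y w
      n = assoc⇒ x y z w (product⇒ x y z k∈) (K.~-trans x z w
            (product⇒ x z w m∈)
            (result-cong x z w (H.~-refl x z) (l⊇ (H.~-refl z w))))
    from : (((x , g , y) ≈ₚ_) ∘⊙ ((y₁ , h , z) ∘ₚᵣ (z₁ , l , w))) ⊆
           (((x , g , y) ∘ₚᵣ (y₁ , h , z)) ∘⊙ ((z₁ , l , w) ≈ₚ_))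
    from {_ , m , _}
         ((_ , g′ , _) , (_ , n , _) , (≡.refl , ≡.refl , _ , g⊇) ,
          (≡.refl , ≡.refl , ≡.refl , n∈) ,
          (≡.refl , ≡.refl , ≡.refl , m∈)) =
      (x , proj₁ k , z) , (z , l , w) , product (proj₁ (proj₂ k)) ,
      ≈ₚ-refl , product (proj₂ (proj₂ k))
      where
      k : ∃ λ k → k ∈ result x y z g h / K x y z ×
                  m ∈ result x z w k l / K x z w
      k = assoc⇐ x y z w (product⇒ y z w n∈) (K.~-trans x y w
            (product⇒ x y w m∈)
            (result-cong x y w (g⊇ (H.~-refl x y)) (H.~-refl y w)))

  identityʳₚ : ∀ a → ((a ≈ₚ_) ∘⊙ Idₚ) ≐ (a ≈ₚ_)
  identityʳₚ (x , g , y) = to , from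
    where
    module M = K x y y
    to : (((x , g , y) ≈ₚ_) ∘⊙ Idₚ) ⊆ ((x , g , y) ≈ₚ_)
    to ((_ , g′ , _) , (_ , i , _) , (≡.refl , ≡.refl , _ , g⊇) ,
        (_ , ≡.refl , ≡.refl , _ , i⊇) , (≡.refl , ≡.refl , ≡.refl , m∈)) =
      ≡.refl , ≡.refl , H.~⇒≐ x y (H.~-sym x y (/-mono (K-xyy x y)
        (M.~-trans (product⇒ x y y m∈) (M.~-trans
          (result-cong x y y (g⊇ (H.~-refl x y)) (i⊇ (H.~-refl y y)))
          (M.≈⇒~ (result-εʳ x y g))))))
    from : ((x , g , y) ≈ₚ_) ⊆ (((x , g , y) ≈ₚ_) ∘⊙ Idₚ)
    from (≡.refl , ≡.refl , _ , m⊇) =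
      (x , g , y) , (y , ε , y) , ≈ₚ-refl , (y , ≈ₚ-refl) ,
      product (M.~-trans (/-mono (Hˡ⊆K x y y) (m⊇ (H.~-refl x y)))
                         (M.≈⇒~ (sym (result-εʳ x y g))))

  identityˡₚ : ∀ a → (Idₚ ∘⊙ (a ≈ₚ_)) ≐ (a ≈ₚ_)
  identityˡₚ (x , g , y) = to , from
    where
    module M = K x x y
    to : (Idₚ ∘⊙ ((x , g , y) ≈ₚ_)) ⊆ ((x , g , y) ≈ₚ_)
    to ((_ , i , _) , (_ , g′ , _) , (_ , ≡.refl , ≡.refl , _ , i⊇) ,
        (≡.refl , ≡.refl , _ , g⊇) , (≡.refl , ≡.refl , ≡.refl , m∈)) =
      ≡.refl , ≡.refl , H.~⇒≐ x y (H.~-sym x y (/-mono (K-xxy x y)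
        (M.~-trans (product⇒ x x y m∈) (M.~-trans
          (result-cong x x y (i⊇ (H.~-refl x x)) (g⊇ (H.~-refl x y)))
          (M.≈⇒~ (result-εˡ x y g))))))
    from : ((x , g , y) ≈ₚ_) ⊆ (Idₚ ∘⊙ ((x , g , y) ≈ₚ_))
    from (≡.refl , ≡.refl , _ , m⊇) =
      (x , ε , x) , (x , g , y) , (x , ≈ₚ-refl) , ≈ₚ-refl ,
      product (M.~-trans (/-mono (Hʳ⊆K x x y) (m⊇ (H.~-refl x y)))
                         (M.≈⇒~ (sym (result-εˡ x y g))))

  cycle₁ₚ : ∀ a b d → (a ∈ b ∘ₚᵣ d) ⇔ (b ∈ a ∘ₚᵣ invₚ d)
  cycle₁ₚ (x , k , z) (x₁ , g , y) (y₁ , h , z₁) = mk⇔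
    (λ { (≡.refl , ≡.refl , ≡.refl , k∈) →
         product (rotate₁ x y z (product⇒ x y z k∈)) })
    (λ { (≡.refl , ≡.refl , ≡.refl , g∈) →
         product (K.~-trans x y z (rotate₁ x z y (product⇒ x z y g∈))
           (result-cong x y z (H.~-refl x y)
             (H.≈⇒~ y z (inverse-twice y z h)))) })

  cycle₂ₚ : ∀ a b d → (a ∈ b ∘ₚᵣ d) ⇔ (d ∈ invₚ b ∘ₚᵣ a)
  cycle₂ₚ (x , k , z) (x₁ , g , y) (y₁ , h , z₁) = mk⇔
    (λ { (≡.refl , ≡.refl , ≡.refl , k∈) →
         product (rotate₂ x y z (product⇒ x y z k∈)) })
    (λ { (≡.refl , ≡.refl , ≡.refl , h∈) →
         product (K.~-trans x y z (rotate₂ y x z (product⇒ y x z h∈))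
           (result-cong x y z (H.≈⇒~ x y (inverse-twice x y g))
             (H.~-refl y z))) })

𝔓 : ∀ {c ℓ} {𝔉 : AbelianGroup c ℓ} → ShiftedSystem 𝔉 →
    Polygroupoid c (c ⊔ ℓ) (c ⊔ ℓ) (c ⊔ ℓ)
𝔓 S = record
  { setoid    = ≈ₚ-setoid
  ; _∘_       = _∘ₚᵣ_
  ; Id        = Idₚ
  ; _⁻¹       = invₚ
  ; ∘-resp    = ∘-resp
  ; Id-resp   = λ a≈a′ (x , e) → x , Setoid.trans ≈ₚ-setoid e a≈a′
  ; ⁻¹-cong   = invₚ-cong
  ; assoc     = assocₚ
  ; identityʳ = identityʳₚ
  ; identityˡ = identityˡₚ
  ; cycle₁    = cycle₁ₚ
  ; cycle₂    = cycle₂ₚ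
  }
  where
  open ShiftedSystem S
  open Verification S

{-# OPTIONS --safe #-}

-- In a representation, choose points u_p, u_s joined by (p , ε , s), and for
-- each x ∈ {q, r, t} a point u_x splitting this edge as (p , ε , x)(x , ε , s).
-- Let g_xy be the label of the pair (u_x , u_y) for x, y ∈ {q, r, t}. The
-- triangles with p and with s put g_xt into H x p ⊙ H x t and H x t ⊙ H x s,
-- hence into H x t, for x = q, r. The triangle q r t then gives
-- g_qr ∈ H q r ⊙ H q t, the triangle q r s gives g_qr ∈ H q r ⊙ H q s, so
-- g_qr ∈ H q r. But the shifted triangle p q r says that α_qp(g_qr) ∙ f lies
-- in H p q ⊙ H p r, so f would lie there too.
module Submission where

open import Algebra.Bundles using (AbelianGroup)
open import Data.Empty using (⊥; ⊥-elim)
open import Data.Fin.Base using (Fin)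
open import Data.Fin.Patterns using (0F; 1F; 2F; 3F)
import Data.Fin.Properties as Fin
open import Data.Product using (∃; _×_; _,_; proj₁; proj₂)
open import Relation.Binary.Bundles using (Setoid)
open import Relation.Binary.PropositionalEquality as ≡ using (_≡_; _≢_; ≢-sym)
open import Relation.Nullary using (¬_; yes; no)
open import Relation.Nullary.Decidable using (from-yes; ¬?; _×-dec_)
open import Relation.Unary using (_∈_)
open import Defs

abstract
  avoid : ∀ (i j k : Fin 4) → ∃ λ l → l ≢ i × l ≢ j × l ≢ k
  avoid = from-yes (Fin.all? {n = 4} λ i → Fin.all? {n = 4} λ j →
    Fin.all? {n = 4} λ k → Fin.any? {n = 4} λ l →
    ¬? (l Fin.≟ i) ×-dec ¬? (l Fin.≟ j) ×-dec ¬? (l Fin.≟ k))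

module LineIntersections {c ℓ} (𝔉 : AbelianGroup c ℓ) where
  private module F = AbelianGroup 𝔉
  open AbelianGroup (cube 𝔉) using (_∙_) renaming (Carrier to G)
  open Cosets (cube 𝔉)
  open Lines 𝔉

  -- (a , b , c) ↦ (a , b , c , ε) identifies F³ with F⁴ modulo its diagonal;
  -- up to sign, the four lines become the images of the coordinate axes.
  coord : Fin 4 → G → F.Carrier
  coord 0F (a , _ , _) = a
  coord 1F (_ , b , _) = b
  coord 2F (_ , _ , d) = d
  coord 3F _           = F.ε

  -- On F⁴ this condition is invariant under the diagonal. It places `g` on axis `i` modulo the
  -- diagonal, with `b` as the diagonal factor.
  ConstantOff : Fin 4 → G → Set _
  ConstantOff i g = ∃ λ b → ∀ k → k ≢ i → coord k g F.≈ b

  line⇒constant : ∀ i {g} → g ∈ L i → ConstantOff i g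
  line⇒constant 0F (_ , _ , e₁ , e₂) = F.ε ,
    λ { 0F n → ⊥-elim (n ≡.refl) ; 1F _ → e₁ ; 2F _ → e₂ ; 3F _ → F.refl }
  line⇒constant 1F (_ , e₀ , _ , e₂) = F.ε ,
    λ { 0F _ → e₀ ; 1F n → ⊥-elim (n ≡.refl) ; 2F _ → e₂ ; 3F _ → F.refl }
  line⇒constant 2F (_ , e₀ , e₁ , _) = F.ε ,
    λ { 0F _ → e₀ ; 1F _ → e₁ ; 2F n → ⊥-elim (n ≡.refl) ; 3F _ → F.refl }
  line⇒constant 3F (a , e₀ , e₁ , e₂) = a ,
    λ { 0F _ → e₀ ; 1F _ → e₁ ; 2F _ → e₂ ; 3F n → ⊥-elim (n ≡.refl) }

  constant⇒line : ∀ i {g} → ConstantOff i g → g ∈ L i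
  constant⇒line i {g@(x₀ , x₁ , x₂)} (b , h) = go i h
    where
    go : ∀ i → (∀ k → k ≢ i → coord k g F.≈ b) → g ∈ L i
    -- For `i` other than `3F`, the coordinate `3F` forces the constant `b` to be `F.ε`.
    go 0F h = x₀ , F.refl , same 1F (λ ()) , same 2F (λ ())
      where same = λ k k≢ → F.trans (h k k≢) (F.sym (h 3F λ ()))
    go 1F h = x₁ , same 0F (λ ()) , F.refl , same 2F (λ ())
      where same = λ k k≢ → F.trans (h k k≢) (F.sym (h 3F λ ()))
    go 2F h = x₂ , same 0F (λ ()) , same 1F (λ ()) , F.refl
      where same = λ k k≢ → F.trans (h k k≢) (F.sym (h 3F λ ()))
    go 3F h = b , h 0F (λ ()) , h 1F (λ ()) , h 2F (λ ())

  coord-∙ : ∀ k {g h h′} → AbelianGroup._≈_ (cube 𝔉) g (h ∙ h′) →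
            coord k g F.≈ coord k h F.∙ coord k h′
  coord-∙ 0F (e , _ , _) = e
  coord-∙ 1F (_ , e , _) = e
  coord-∙ 2F (_ , _ , e) = e
  coord-∙ 3F _           = F.sym (F.identityˡ F.ε)

  -- Coordinates `k` and `l` agree on each of the two lines, and coordinates are multiplicative.
  plane⇒≈ : ∀ {i j k l g} → k ≢ i → k ≢ j → l ≢ i → l ≢ j →
            g ∈ L i ⊙ L j → coord k g F.≈ coord l g
  plane⇒≈ {i} {j} {k} {l} k≢i k≢j l≢i l≢j (_ , _ , a∈ , b∈ , e)
    with line⇒constant i a∈ | line⇒constant j b∈
  ... | _ , ca | _ , cb = F.trans (coord-∙ k e) (F.trans
    (F.∙-cong (F.trans (ca k k≢i) (F.sym (ca l l≢i)))
              (F.trans (cb k k≢j) (F.sym (cb l l≢j))))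
    (F.sym (coord-∙ l e)))

  -- A coordinate `l` outside `i`, `j`, `k` serves as reference: the first plane ties every
  -- coordinate except `i` and `j` to it, and the second plane ties `j`.
  planes⇒line : ∀ {i j k g} → i ≢ j → i ≢ k → j ≢ k →
                g ∈ L i ⊙ L j → g ∈ L i ⊙ L k → g ∈ L i
  planes⇒line {i} {j} {k} {g} i≢j i≢k j≢k ij ik =
    constant⇒line i (coord l g , equal)
    where
    l = proj₁ (avoid i j k)
    l≢i = proj₁ (proj₂ (avoid i j k))
    l≢j = proj₁ (proj₂ (proj₂ (avoid i j k)))
    l≢k = proj₂ (proj₂ (proj₂ (avoid i j k)))
    equal : ∀ m → m ≢ i → coord m g F.≈ coord l g
    equal m m≢i with m Fin.≟ j
    ... | no  m≢j    = plane⇒≈ m≢i m≢j l≢i l≢j ij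
    ... | yes ≡.refl = plane⇒≈ m≢i j≢k l≢i l≢k ik

module _ {c ℓ} {𝔉 : AbelianGroup c ℓ} (S : ShiftedSystem 𝔉) where
  open AbelianGroup (cube 𝔉) renaming (Carrier to G)
  open Cosets (cube 𝔉)
  open CosetProperties (cube 𝔉)
  open LineIntersections 𝔉
  open ShiftedSystem S
  open Verification S renaming (product to result⇒∈∘)

  K⇒LL : ∀ {x y z} → x ≢ y → x ≢ z → ∀ {g} → g ∈ K x y z →
         g ∈ Lines.L 𝔉 (line x y) ⊙ Lines.L 𝔉 (line x z)
  K⇒LL x≢y x≢z (a , b , a∈ , b∈ , e) = a , b , H⇒L x≢y a∈ , H⇒L x≢z b∈ , e

  K∩K⊆H : ∀ {x y z w} → x ≢ y → x ≢ z → x ≢ w → y ≢ z → y ≢ w → z ≢ w →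
          ∀ {g} → g ∈ K x y z → g ∈ K x y w → g ∈ H x y
  K∩K⊆H x≢y x≢z x≢w y≢z y≢w z≢w yz yw = L⇒H x≢y (planes⇒line
    (line-injective (≢-sym x≢y) (≢-sym x≢z) y≢z)
    (line-injective (≢-sym x≢y) (≢-sym x≢w) y≢w)
    (line-injective (≢-sym x≢z) (≢-sym x≢w) z≢w)
    (K⇒LL x≢y x≢z yz) (K⇒LL x≢y x≢w yw))

  module _ (x y z : I) where
    private module M = K x y z

    ε~⇒∈K : ∀ {a} → ε M.~ a → a ∈ K x y z
    ε~⇒∈K ε~a with M.~-sym ε~a
    ... | _ , b∈ , e =
      IsSubgroup.resp (K-sub x y z) (sym (trans e (identityˡ _))) b∈

    -- The constraint from a triangle whose two edges at `x` carry `ε`. The shift is kept because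
    -- the triangle p q r is among the applications.
    result-εˡ-∈K : ∀ {h} → ε ∈ result x y z ε h / K x y z →
                   αᵢ y x h ∙ shift x y z ∈ K x y z
    result-εˡ-∈K ε~ = ε~⇒∈K (M.~-trans ε~ (M.≈⇒~ (∙-congʳ (identityˡ _))))

    result-εʳ-∈K : kind x y z ≡ neither → ∀ {g} →
                   ε ∈ result x y z g ε / K x y z → g ∈ K x y z
    result-εʳ-∈K n ε~ = ε~⇒∈K (M.~-trans ε~ (M.≈⇒~
      (trans (∙-cong (trans (∙-congˡ (αᵢ-ε y x)) (identityʳ _))
                     (shift-neither x y z n))
             (identityʳ _))))

    -- Applying `αᵢ x y` moves the constraint from the vertex `x` to the vertex `y`.
    result-εˡ-∈K′ : kind x y z ≡ neither → ∀ {h} →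
                    ε ∈ result x y z ε h / K x y z → h ∈ K y x z
    result-εˡ-∈K′ n ε~ = IsSubgroup.resp (K-sub y x z)
      (trans (αᵢ-cong x y (trans (∙-congˡ (shift-neither x y z n))
                                 (identityʳ _)))
             (αᵢ-inverse y x _))
      (αᵢ-K y x z (result-εˡ-∈K ε~))

  module _ {u ℓᵤ ρ} {𝕌 : Setoid u ℓᵤ} (R : Representation (𝔓 S) 𝕌 ρ) where
    open Representation R
    private U = Setoid.Carrier 𝕌

    compose : ∀ {x y z g h a b d} →
      rep (x , g , y) a b → rep (y , h , z) b d →
      ∃ λ k → k ∈ result x y z g h / K x y z × rep (x , k , z) a d
    compose {x} {y} {z} ab bd with proj₁ (product _ _) (_ , ab , bd)
    ... | (_ , k , _) , (≡.refl , ≡.refl , ≡.refl , k∈) , ad =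
      k , product⇒ x y z k∈ , ad

    split : ∀ {x y z g h k a d} → k ∈ result x y z g h / K x y z →
      rep (x , k , z) a d → ∃ λ b → rep (x , g , y) a b × rep (y , h , z) b d
    split k~ ad = proj₂ (product _ _) (_ , result⇒∈∘ k~ , ad)

    -- By disjointness, the label found by composing cannot differ from `k`. This only refutes,
    -- hence the double negation, which is harmless since the final goal is `⊥`.
    triangle : ∀ {x y z g h k a b d} →
      rep (x , g , y) a b → rep (y , h , z) b d → rep (x , k , z) a d →
      ¬ ¬ (k ∈ result x y z g h / K x y z)
    triangle {x} {y} {z} {k = k} ab bd ad ∉ with compose ab bd
    ... | l , l~ , ad′ = disjoint l≉k (ad′ , ad)
      where
      l≉k : ¬ ((x , l , z) ≈ₚ (x , k , z))
      l≉k (_ , _ , _ , k⊆l) = ∉ (K.~-trans x y z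
        (/-mono (Hʳ⊆K x y z) (k⊆l (H.~-refl x z))) l~)

    Between : U → U → I → U → Set _
    Between a d x b = rep (p , ε , x) a b × rep (x , ε , s) b d

    between : ∀ {a d} x → kind p x s ≡ neither →
              rep (p , ε , s) a d → ∃ (Between a d x)
    between x n = split (K.≈⇒~ p x s (sym (trans
      (∙-cong (trans (identityˡ _) (αᵢ-ε x p)) (shift-neither p x s n))
      (identityˡ ε))))

    label : ∀ {a d b b′ x y} → Between a d x b → Between a d y b′ →
            ∃ λ g → rep (x , g , y) b b′
    label (ab , _) (ab′ , _) with compose (proj₁ (converse _) ab) ab′
    ... | g , _ , bb′ = g , bb′

    -- The unshifted triangles with apex at `p` and at `s` confine `g` to two planes that meet in
    -- `H x y`. The pair q, r is excluded, as `kind p q r` is `positive`.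
    label-∈H : ∀ {a d b b′ x y g} → kind p x y ≡ neither →
      kind x y s ≡ neither → x ≢ y → x ≢ p → x ≢ s → y ≢ p → y ≢ s →
      Between a d x b → Between a d y b′ → rep (x , g , y) b b′ →
      ¬ ¬ (g ∈ H x y)
    label-∈H {x = x} {y} np ns x≢y x≢p x≢s y≢p y≢s (ab , bd) (ab′ , b′d) bb′ ∉ =
      triangle ab bb′ ab′ λ pxy → triangle bb′ b′d bd λ xys →
      ∉ (K∩K⊆H x≢y x≢s x≢p y≢s y≢p (λ ())
          (result-εʳ-∈K x y s ns xys)
          (K-comm x p y (result-εˡ-∈K′ p x y np pxy)))

    unrepresentable : ⊥
    unrepresentable =
      let _ , _ , ad = nonempty (p , ε , s)
          _ , bq = between q ≡.refl ad
          _ , br = between r ≡.refl ad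
          _ , bt = between t ≡.refl ad
          gqr , qr = label bq br
          gqt , qt = label bq bt
          grt , rt = label br bt
      in
      label-∈H ≡.refl ≡.refl (λ ()) (λ ()) (λ ()) (λ ()) (λ ()) bq bt qt
        λ gqt∈ →
      label-∈H ≡.refl ≡.refl (λ ()) (λ ()) (λ ()) (λ ()) (λ ()) br bt rt
        λ grt∈ →
      triangle (proj₁ bq) qr (proj₁ br) λ pqr →
      triangle qr (proj₂ br) (proj₂ bq) λ qrs →
      triangle qr rt qt λ qrt →
      let gqr∈Kqrt : gqr ∈ K q r t
          -- Modulo `K q r t` both `gqt` and the image of `grt` vanish, so the unshifted triangle
          -- leaves only `gqr`.
          gqr∈Kqrt = ε~⇒∈K q r t (QRT.~-trans
            (QRT.∈⇒~ (IsSubgroup.ε∈ (K-sub q r t)) (Hʳ⊆K q r t gqt∈))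
            (QRT.~-trans qrt (QRT.~-trans
              (QRT.~-∙ (QRT.~-∙ QRT.~-refl
                         (QRT.∈⇒~ (αᵢ-H q r t grt∈)
                                  (IsSubgroup.ε∈ (K-sub q r t))))
                       QRT.~-refl)
              (QRT.≈⇒~ (trans (identityʳ _) (identityʳ _))))))
          gqr∈Hqr : gqr ∈ H q r
          gqr∈Hqr = K∩K⊆H {q} {r} {s} {t}
            (λ ()) (λ ()) (λ ()) (λ ()) (λ ()) (λ ())
            (result-εʳ-∈K q r s ≡.refl qrs) gqr∈Kqrt
      -- Cancelling the image of `gqr` from the relation of p q r leaves its shift `f`.
      in f∉ (IsSubgroup.resp (K-sub p q r)
        (trans (sym (assoc _ _ _))
          (trans (∙-congʳ (inverseˡ _)) (identityˡ f)))
        (IsSubgroup.∙∈ (K-sub p q r)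
          (IsSubgroup.⁻¹∈ (K-sub p q r) (αᵢ-H p q r gqr∈Hqr))
          (result-εˡ-∈K p q r pqr)))
      where module QRT = K q r t

theorem4p2 : ∀ {c ℓ u ℓᵤ r} (𝔉 : AbelianGroup c ℓ) → NonTrivial 𝔉 →
    (S : ShiftedSystem 𝔉) → ¬ Representable (𝔓 S) u ℓᵤ r
theorem4p2 𝔉 _ S (_ , R) = unrepresentable S R
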